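{- For nonnegative integers $n$ and $k$, $|\mathcal{T}_{n,k}|=|\mathcal{F}_{n,k}|$; that is, $$\sum_{m=k}^n \binom{n+1}{m+1} S(m+1,k+1)\, k!\, (n-k)^{n-m-1} (m-k) = \sum_{i=0}^k (-1)^{i}\binom{k}{i}(n-i)^n,$$ where $S(a,b)$ denotes the Stirling number of the second kind.
   Context: $\mathcal{T}_n$ is the set of rooted labeled trees on vertex set $[0,n]=\{0,\dots,n\}$. For $T\in\mathcal{T}_n$, $\mathrm{MD}(T)$ (maximal decreasing subtree) is the subtree induced by the root and all vertices $v$ such that labels strictly decrease along the path from the root to $v$. $\mathcal{T}_{n,k}$ is the set of $T\in\mathcal{T}_n$ with $\mathrm{MD}(T)$ having exactly $k+1$ vertices. $[n]=\{1,\dots,n\}$ ($[0]=\emptyset$); $\mathcal{F}_{n,k}$ is the set of functions $f:[n]\to[n]$ with $[k]\subseteq f([n])$. Convention $0^0=1$; in the left-hand sum the factor $(n-k)^{n-m-1}(m-k)$ is interpreted as $1$ when $m=n$. -}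

module Defs where

open import Data.Nat using (ℕ; zero; suc; _+_; _*_; _∸_; _^_; _<ᵇ_; _≤ᵇ_; _≡ᵇ_; _!)
open import Data.Nat.Combinatorics using (_C_)
open import Data.Integer as ℤ using (ℤ; +_)
open import Data.Bool using (Bool; true; false; _∧_; if_then_else_)
open import Data.Maybe using (Maybe; just; nothing)
open import Data.Fin using (Fin; toℕ)
open import Data.Vec using (Vec; []; _∷_; lookup)
open import Data.List using (List; []; _∷_; map; concatMap; length; filter; allFin; upTo; foldr)
open import Data.Bool.ListAction using (all; any)
open import Data.Nat.ListAction using (sum)
open import Data.Bool.Properties using (T?)

allVecs : {A : Set} → List A → (m : ℕ) → List (Vec A m)
allVecs xs zero    = [] ∷ []
allVecs xs (suc m) = concatMap (λ x → map (x ∷_) (allVecs xs m)) xs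

allMaybe : {A : Set} → List A → List (Maybe A)
allMaybe xs = nothing ∷ map just xs

count : {A : Set} → (A → Bool) → List A → ℕ
count P xs = length (filter (λ x → T? (P x)) xs)

-- Rooted labeled trees on vertex set [0,n] = Fin (suc n), encoded by
-- their parent map: vertex v has parent (just u), the root has parent
-- nothing.  Such a map is a rooted tree iff exactly one vertex has
-- no parent and following parents from any vertex reaches a
-- parentless vertex (no cycles).  Paths have ≤ n edges, so fuel
-- suc n is enough.

Parent : ℕ → Set
Parent n = Vec (Maybe (Fin (suc n))) (suc n)

isRoot : ∀ {n} → Parent n → Fin (suc n) → Bool
isRoot p v with lookup p v
... | nothing = true
... | just _  = false

reachesRoot : ∀ {n} → Parent n → ℕ → Fin (suc n) → Bool
reachesRoot p fuel v with lookup p v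
reachesRoot p fuel       v | nothing = true
reachesRoot p zero       v | just u  = false
reachesRoot p (suc fuel) v | just u  = reachesRoot p fuel u

isTree : ∀ {n} → Parent n → Bool
isTree {n} p = (count (isRoot p) (allFin (suc n)) ≡ᵇ 1)
             ∧ all (reachesRoot p (suc n)) (allFin (suc n))

-- v ∈ MD(T): the labels strictly decrease along the path from the
-- root to v, i.e. strictly increase when walking from v up to the root.
inMD : ∀ {n} → Parent n → ℕ → Fin (suc n) → Bool
inMD p fuel v with lookup p v
inMD p fuel       v | nothing = true
inMD p zero       v | just u  = false
inMD p (suc fuel) v | just u  = (toℕ v <ᵇ toℕ u) ∧ inMD p fuel u

mdSize : ∀ {n} → Parent n → ℕ
mdSize {n} p = count (inMD p (suc n)) (allFin (suc n))

cardT : ℕ → ℕ → ℕ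
cardT n k = count (λ p → isTree p ∧ (mdSize p ≡ᵇ suc k))
                  (allVecs (allMaybe (allFin (suc n))) (suc n))

-- Functions f : [n] → [n], encoded as Vec (Fin n) n, where entry i
-- (i : Fin n) holds f(i+1) - 1.  Value j ∈ [n] corresponds to toℕ = j-1.

-- [k] ⊆ f([n])  (false when k > n, since then k ∉ [n])
coversK : ∀ {n} → ℕ → Vec (Fin n) n → Bool
coversK {n} k f = (k ≤ᵇ n)
  ∧ all (λ j → if toℕ j <ᵇ k
               then any (λ i → toℕ (lookup f i) ≡ᵇ toℕ j) (allFin n)
               else true)
        (allFin n)

cardF : ℕ → ℕ → ℕ
cardF n k = count (coversK k) (allVecs (allFin n) n)

S₂ : ℕ → ℕ → ℕ
S₂ zero    zero    = 1
S₂ zero    (suc b) = 0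
S₂ (suc a) zero    = 0
S₂ (suc a) (suc b) = suc b * S₂ a (suc b) + S₂ a b

-- Σ_{i=a}^{b} f i  (empty, i.e. 0, when b < a)
sumFromTo : ℕ → ℕ → (ℕ → ℕ) → ℕ
sumFromTo a b f = sum (map (λ i → f (a + i)) (upTo (suc b ∸ a)))

sumℤ : ℕ → (ℕ → ℤ) → ℤ
sumℤ k f = foldr ℤ._+_ (+ 0) (map f (upTo (suc k)))

-- the factor (n-k)^{n-m-1}(m-k), read as 1 when m = n
factor : ℕ → ℕ → ℕ → ℕ
factor n k m = if m ≡ᵇ n then 1 else (n ∸ k) ^ (n ∸ m ∸ 1) * (m ∸ k)

lhs : ℕ → ℕ → ℕ
lhs n k = sumFromTo k n (λ m → (suc n C suc m) * S₂ (suc m) (suc k) * (k !) * factor n k m)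

rhs : ℕ → ℕ → ℤ
rhs n k = sumℤ k (λ i → (ℤ.- (+ 1)) ℤ.^ i ℤ.* (+ (k C i)) ℤ.* ((+ n ℤ.- + i) ℤ.^ n))

{-# OPTIONS --safe #-}
-- All four quantities equal Δ^k t^n at t = n - k, where Δ is the forward difference.
--
-- Functions: if c(r, N) counts the words of length N over [n] hitting r prescribed letters, then
-- c(r, N+1) = (n-r) c(r, N) + r c(r-1, N), which is the Leibniz rule for Δ^r (t · t^N) at n - r.
--
-- Trees: fix the vertex set M of the maximal decreasing subtree and let X be its complement.  The
-- condition MD(T) = M restricts the parent of each vertex separately, apart from acyclicity.
-- A vertex of X may choose its parent among all of X and the smaller elements of M, a vertex of M
-- among the larger elements of M.  Counting acyclic choices is a determinant, evaluated by
-- eliminating vertices one by one (children of an eliminated vertex pass to its parent), which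
-- preserves the row totals b_v.  The result is Π_v b_v - Σ_{u ∈ X} Π_{v ≠ u} b_v.  Summed over all
-- M with k+1 elements, the first product gives Δ^(k+1) t^(n+1) / (k+1) and the second its derivative
-- (n+1) Δ^(k+1) t^n / (k+1), both at t = n - k, and the Leibniz rule turns the difference into Δ^k t^n.
-- The Stirling sum on the left-hand side has the same two-term form.
module Submission where

open import Defs
open import Data.Bool using (Bool; true; false; if_then_else_; T; not; _∧_; _∨_)
open import Data.Bool.ListAction using (all; any)
import Data.Bool.Properties as Bool
open import Data.Bool.Properties using (T-∧; T-≡)
open import Data.Empty using (⊥; ⊥-elim)
open import Data.Fin using (Fin; zero; suc; toℕ)
import Data.Fin.Properties as Fin
open import Data.Integer using (ℤ; +_; 0ℤ; 1ℤ; -1ℤ; -_; _+_; _-_; _*_; _^_)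
import Data.Integer.Properties as ℤ
open import Data.Integer.Tactic.RingSolver using (solve-∀)
open import Data.List using (List; []; _∷_; _++_; _∷ʳ_; map; concatMap; foldr; allFin; upTo)
import Data.List.Properties as List
import Data.List.Relation.Unary.All.Properties as All
import Data.List.Relation.Unary.Any.Properties as Any
open import Data.Maybe as Maybe using (Maybe; just; nothing)
import Data.Maybe.Properties as Maybe
open import Data.Nat as ℕ using (ℕ; zero; suc; _!; _≤_; _<_; z≤n; s≤s; _∸_; _⊔_)
open import Data.Nat.Combinatorics using (_C_)
import Data.Nat.Combinatorics as C
import Data.Nat.ListAction as ℕ using (sum)
import Data.Nat.Properties as ℕ
open import Data.Product using (∃; _×_; _,_; proj₁; proj₂)
open import Data.Unit using (tt)
open import Data.Vec as Vec using (Vec; []; _∷_; lookup)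
import Data.Vec.Properties as Vec
open import Function using (_∘_; id)
open import Function.Bundles using (Equivalence)
open import Relation.Binary.Definitions using (tri<; tri≈; tri>)
open import Relation.Binary.PropositionalEquality
open import Relation.Nullary using (¬_; yes; no; does; contradiction)

open ≡-Reasoning
open Equivalence

variable
  A B : Set

-- Finite sums of integers

⟦_⟧ : Bool → ℤ
⟦ true ⟧  = 1ℤ
⟦ false ⟧ = 0ℤ

-- Opaque, so that unification recovers f from ∑ xs f even when xs is a concrete list.
opaque
  ∑ : List A → (A → ℤ) → ℤ
  ∑ []       f = 0ℤ
  ∑ (x ∷ xs) f = f x + ∑ xs f

  ∑-cong : ∀ (xs : List A) {f g} → (∀ x → f x ≡ g x) → ∑ xs f ≡ ∑ xs g
  ∑-cong []       e = refl
  ∑-cong (x ∷ xs) e = cong₂ _+_ (e x) (∑-cong xs e)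

  ∑-[] : ∀ (f : A → ℤ) → ∑ [] f ≡ 0ℤ
  ∑-[] f = refl

  ∑-∷ : ∀ (x : A) xs f → ∑ (x ∷ xs) f ≡ f x + ∑ xs f
  ∑-∷ x xs f = refl

  ∑-[-] : ∀ (x : A) f → ∑ (x ∷ []) f ≡ f x
  ∑-[-] x f = ℤ.+-identityʳ (f x)

  ∑-zero : ∀ (xs : List A) → ∑ xs (λ _ → 0ℤ) ≡ 0ℤ
  ∑-zero []       = refl
  ∑-zero (x ∷ xs) = trans (ℤ.+-identityˡ _) (∑-zero xs)

  ∑-+ : ∀ (xs : List A) f g → ∑ xs (λ x → f x + g x) ≡ ∑ xs f + ∑ xs g
  ∑-+ []       f g = refl
  ∑-+ (x ∷ xs) f g rewrite ∑-+ xs f g = swap-middle (f x) (g x) (∑ xs f) (∑ xs g)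
    where
    swap-middle : ∀ a b c d → (a + b) + (c + d) ≡ (a + c) + (b + d)
    swap-middle = solve-∀

  ∑-*ˡ : ∀ (xs : List A) c f → ∑ xs (λ x → c * f x) ≡ c * ∑ xs f
  ∑-*ˡ []       c f = sym (ℤ.*-zeroʳ c)
  ∑-*ˡ (x ∷ xs) c f rewrite ∑-*ˡ xs c f = sym (ℤ.*-distribˡ-+ c (f x) (∑ xs f))

  ∑-*ʳ : ∀ (xs : List A) c f → ∑ xs (λ x → f x * c) ≡ ∑ xs f * c
  ∑-*ʳ xs c f = trans (∑-cong xs (λ x → ℤ.*-comm (f x) c)) (trans (∑-*ˡ xs c f) (ℤ.*-comm c _))

  ∑-neg : ∀ (xs : List A) f → ∑ xs (λ x → - f x) ≡ - ∑ xs f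
  ∑-neg []       f = refl
  ∑-neg (x ∷ xs) f rewrite ∑-neg xs f = sym (ℤ.neg-distrib-+ (f x) _)

  ∑-- : ∀ (xs : List A) f g → ∑ xs (λ x → f x - g x) ≡ ∑ xs f - ∑ xs g
  ∑-- xs f g = trans (∑-+ xs f (-_ ∘ g)) (cong (_+_ (∑ xs f)) (∑-neg xs g))

  ∑-map : ∀ (h : A → B) xs f → ∑ (map h xs) f ≡ ∑ xs (f ∘ h)
  ∑-map h []       f = refl
  ∑-map h (x ∷ xs) f = cong (_+_ (f (h x))) (∑-map h xs f)

  ∑-++ : ∀ (xs ys : List A) f → ∑ (xs ++ ys) f ≡ ∑ xs f + ∑ ys f
  ∑-++ []       ys f = sym (ℤ.+-identityˡ _)
  ∑-++ (x ∷ xs) ys f rewrite ∑-++ xs ys f = sym (ℤ.+-assoc (f x) _ _)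

  ∑-concatMap : ∀ (h : A → List B) xs f → ∑ (concatMap h xs) f ≡ ∑ xs (λ x → ∑ (h x) f)
  ∑-concatMap h []       f = refl
  ∑-concatMap h (x ∷ xs) f = trans (∑-++ (h x) _ f) (cong (_+_ (∑ (h x) f)) (∑-concatMap h xs f))

  ∑-swap : ∀ (xs : List A) (ys : List B) (f : A → B → ℤ) →
           ∑ xs (λ x → ∑ ys (f x)) ≡ ∑ ys (λ y → ∑ xs (λ x → f x y))
  ∑-swap []       ys f = sym (∑-zero ys)
  ∑-swap (x ∷ xs) ys f rewrite ∑-swap xs ys f = sym (∑-+ ys (f x) _)

  ∑-allFin-suc : ∀ {n} (f : Fin (suc n) → ℤ) → ∑ (allFin (suc n)) f ≡ f zero + ∑ (allFin n) (f ∘ suc)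
  ∑-allFin-suc f = cong (_+_ (f zero))
    (trans (cong (λ xs → ∑ xs f) (sym (List.map-tabulate id suc))) (∑-map suc (allFin _) f))

  ∑-upTo-suc : ∀ n f → ∑ (upTo (suc n)) f ≡ f 0 + ∑ (upTo n) (f ∘ suc)
  ∑-upTo-suc n f = cong (_+_ (f 0))
    (trans (cong (λ xs → ∑ xs f) (sym (List.map-upTo suc n))) (∑-map suc (upTo n) f))

  ∑-upTo-last : ∀ n f → ∑ (upTo (suc n)) f ≡ ∑ (upTo n) f + f n
  ∑-upTo-last n f = begin
    ∑ (upTo (suc n)) f     ≡⟨ cong (λ xs → ∑ xs f) (sym (List.upTo-∷ʳ n)) ⟩
    ∑ (upTo n ∷ʳ n) f      ≡⟨ ∑-++ (upTo n) _ f ⟩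
    ∑ (upTo n) f + (f n + 0ℤ) ≡⟨ cong (_+_ (∑ (upTo n) f)) (ℤ.+-identityʳ (f n)) ⟩
    ∑ (upTo n) f + f n     ∎

  ∑-upTo-+ : ∀ m n f → ∑ (upTo (m ℕ.+ n)) f ≡ ∑ (upTo m) f + ∑ (upTo n) (λ i → f (m ℕ.+ i))
  ∑-upTo-+ zero    n f = sym (ℤ.+-identityˡ _)
  ∑-upTo-+ (suc m) n f = begin
    ∑ (upTo (suc m ℕ.+ n)) f                        ≡⟨ ∑-upTo-suc (m ℕ.+ n) f ⟩
    f 0 + ∑ (upTo (m ℕ.+ n)) (f ∘ suc)              ≡⟨ cong (_+_ (f 0)) (∑-upTo-+ m n (f ∘ suc)) ⟩
    f 0 + (∑ (upTo m) (f ∘ suc) + tail)             ≡⟨ sym (ℤ.+-assoc (f 0) _ tail) ⟩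
    f 0 + ∑ (upTo m) (f ∘ suc) + tail               ≡⟨ cong (_+ tail) (sym (∑-upTo-suc m f)) ⟩
    ∑ (upTo (suc m)) f + tail                       ∎
    where
    tail : ℤ
    tail = ∑ (upTo n) (λ i → f (suc m ℕ.+ i))

  ∑-upTo-cong : ∀ n {f g} → (∀ i → i < n → f i ≡ g i) → ∑ (upTo n) f ≡ ∑ (upTo n) g
  ∑-upTo-cong zero            e = refl
  ∑-upTo-cong (suc n) {f} {g} e = begin
    ∑ (upTo (suc n)) f            ≡⟨ ∑-upTo-suc n f ⟩
    f 0 + ∑ (upTo n) (f ∘ suc)    ≡⟨ cong₂ _+_ (e 0 (s≤s z≤n)) (∑-upTo-cong n (λ i i<n → e (suc i) (s≤s i<n))) ⟩
    g 0 + ∑ (upTo n) (g ∘ suc)    ≡⟨ sym (∑-upTo-suc n g) ⟩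
    ∑ (upTo (suc n)) g            ∎

  ∑-allVecs-suc : ∀ (xs : List A) m f →
                  ∑ (allVecs xs (suc m)) f ≡ ∑ xs (λ x → ∑ (allVecs xs m) (λ v → f (x ∷ v)))
  ∑-allVecs-suc xs m f = trans (∑-concatMap _ xs f) (∑-cong xs (λ x → ∑-map (x ∷_) (allVecs xs m) f))

  ∑-count : ∀ (P : A → Bool) xs → + count P xs ≡ ∑ xs (⟦_⟧ ∘ P)
  ∑-count P []       = refl
  ∑-count P (x ∷ xs) with P x
  ... | true  = cong (_+_ 1ℤ) (∑-count P xs)
  ... | false = trans (∑-count P xs) (sym (ℤ.+-identityˡ _))

T-ext : ∀ {a b} → (T a → T b) → (T b → T a) → a ≡ b
T-ext {false} {false} f g = refl
T-ext {false} {true}  f g = ⊥-elim (g _)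
T-ext {true}  {false} f g = ⊥-elim (f _)
T-ext {true}  {true}  f g = refl

all-allFin⁺ : ∀ {n} (P : Fin n → Bool) → (∀ i → T (P i)) → T (all P (allFin n))
all-allFin⁺ P h = All.all⁻ P (All.tabulate⁺ h)

all-allFin⁻ : ∀ {n} (P : Fin n → Bool) → T (all P (allFin n)) → ∀ i → T (P i)
all-allFin⁻ P t = All.tabulate⁻ (All.all⁺ P _ t)

any-allFin⁺ : ∀ {n} (P : Fin n → Bool) i → T (P i) → T (any P (allFin n))
any-allFin⁺ P i t = Any.any⁺ P (Any.tabulate⁺ i t)

any-allFin⁻ : ∀ {n} (P : Fin n → Bool) → T (any P (allFin n)) → ∃ λ i → T (P i)
any-allFin⁻ P t = Any.tabulate⁻ (Any.any⁻ P _ t)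

∑-const : ∀ n c → ∑ (allFin n) (λ _ → c) ≡ + n * c
∑-const zero    c = trans (∑-[] _) (sym (ℤ.*-zeroˡ c))
∑-const (suc n) c = begin
  ∑ (allFin (suc n)) (λ _ → c)   ≡⟨ ∑-allFin-suc _ ⟩
  c + ∑ (allFin n) (λ _ → c)     ≡⟨ cong (_+_ c) (∑-const n c) ⟩
  c + + n * c                    ≡⟨ sym (ℤ.suc-* (+ n) c) ⟩
  + suc n * c ∎

∑-zero-cong : ∀ (xs : List A) {f} → (∀ x → f x ≡ 0ℤ) → ∑ xs f ≡ 0ℤ
∑-zero-cong xs e = trans (∑-cong xs e) (∑-zero xs)

∑-sift : ∀ {n} (i : Fin n) (f : Fin n → ℤ) → ∑ (allFin n) (λ j → ⟦ does (i Fin.≟ j) ⟧ * f j) ≡ f i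
∑-sift {suc n} zero    f = begin
  ∑ (allFin (suc n)) (λ j → ⟦ does (zero Fin.≟ j) ⟧ * f j)  ≡⟨ ∑-allFin-suc _ ⟩
  1ℤ * f zero + ∑ (allFin n) (λ j → 0ℤ * f (suc j))
    ≡⟨ cong₂ _+_ (ℤ.*-identityˡ (f zero)) (∑-zero-cong (allFin n) (λ j → ℤ.*-zeroˡ (f (suc j)))) ⟩
  f zero + 0ℤ                                               ≡⟨ ℤ.+-identityʳ (f zero) ⟩
  f zero ∎
∑-sift {suc n} (suc i) f = begin
  ∑ (allFin (suc n)) (λ j → ⟦ does (suc i Fin.≟ j) ⟧ * f j)  ≡⟨ ∑-allFin-suc _ ⟩
  0ℤ * f zero + ∑ (allFin n) (λ j → ⟦ does (i Fin.≟ j) ⟧ * f (suc j))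
    ≡⟨ cong₂ _+_ (ℤ.*-zeroˡ (f zero)) (∑-sift i (f ∘ suc)) ⟩
  0ℤ + f (suc i)                                             ≡⟨ ℤ.+-identityˡ (f (suc i)) ⟩
  f (suc i) ∎

-- Finite differences of powers

Δ : ℕ → ℕ → ℤ → ℤ
Δ zero    N y = y ^ N
Δ (suc r) N y = Δ r N (y + 1ℤ) - Δ r N y

-- The factor `y` has first difference 1 and zero higher differences, so the Leibniz rule has only
-- two terms. At `r = 0` the truncated `ℕ.pred r` is multiplied by zero.
Δ-leibniz : ∀ r N y → Δ r (suc N) y ≡ y * Δ r N y + + r * Δ (ℕ.pred r) N (y + 1ℤ)
Δ-leibniz zero    N y = sym (ℤ.+-identityʳ _)
-- Separate because the general step takes differences of the lower-order term of the rule, which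
-- `ℕ.pred` truncates at order zero.
Δ-leibniz (suc zero) N y = identity y (y ^ N) ((y + 1ℤ) ^ N)
  where
  identity : ∀ y p q → (y + 1ℤ) * q - y * p ≡ y * (q - p) + 1ℤ * q
  identity = solve-∀
Δ-leibniz (suc (suc r)) N y
  = trans (cong₂ _-_ (Δ-leibniz (suc r) N (y + 1ℤ)) (Δ-leibniz (suc r) N y))
      (identity y (+ suc r) (Δ r N y) (Δ r N (y + 1ℤ)) (Δ r N (y + 1ℤ + 1ℤ)))
  where
  identity : ∀ y r a b c → (y + 1ℤ) * (c - b) + r * c - (y * (b - a) + r * b)
                           ≡ y * ((c - b) - (b - a)) + (1ℤ + r) * (c - b)
  identity = solve-∀

-- Writing Δ^r at `y + 1ℤ` as Δ^r + Δ^(r+1) at `y` leaves a single base point, which is the shape of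
-- the Stirling recurrence.
Δ-leibniz′ : ∀ r N y → Δ (suc r) (suc N) y ≡ (y + + suc r) * Δ (suc r) N y + + suc r * Δ r N y
Δ-leibniz′ r N y = trans (Δ-leibniz (suc r) N y) (identity y (+ suc r) (Δ r N y) (Δ r N (y + 1ℤ)))
  where
  identity : ∀ y r a b → y * (b - a) + r * b ≡ (y + r) * (b - a) + r * a
  identity = solve-∀

-- In both terms of the Leibniz rule the exponent drops by one and the order by at most one, so the
-- exponent stays below the order.
Δ-vanish : ∀ {r N} → N < r → ∀ y → Δ r N y ≡ 0ℤ
Δ-vanish {suc zero}    {zero}  _ y = refl
Δ-vanish {suc (suc r)} {zero}  _ y
  = cong₂ _-_ (Δ-vanish {suc r} (s≤s z≤n) (y + 1ℤ)) (Δ-vanish {suc r} (s≤s z≤n) y)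
Δ-vanish {suc r}       {suc N} (s≤s N<r) y = begin
  Δ (suc r) (suc N) y                                  ≡⟨ Δ-leibniz (suc r) N y ⟩
  y * Δ (suc r) N y + + suc r * Δ r N (y + 1ℤ)
    ≡⟨ cong₂ (λ a b → y * a + + suc r * b) (Δ-vanish (ℕ.m<n⇒m<1+n N<r) y) (Δ-vanish N<r (y + 1ℤ)) ⟩
  y * 0ℤ + + suc r * 0ℤ                                ≡⟨ cong₂ _+_ (ℤ.*-zeroʳ y) (ℤ.*-zeroʳ (+ suc r)) ⟩
  0ℤ                                                   ∎

-- At the point n - k the coefficients n - k and n + 1 of Δ^(k+1) differ by k + 1, which brings the
-- remaining Δ^k back from the next point to n - k. The trees and the Stirling sum both reduce to
-- this two-term form.
Δ-difference : ∀ n k → let x = + n - + k in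
  Δ (suc k) (suc n) x - + suc n * Δ (suc k) n x ≡ + suc k * Δ k n x
Δ-difference n k = trans (cong (_- (+ suc n * Δ (suc k) n x)) (Δ-leibniz (suc k) n x))
  (identity (+ n) (+ k) (Δ k n x) (Δ k n (x + 1ℤ)))
  where
  x = + n - + k
  identity : ∀ n k a b → (n - k) * (b - a) + (1ℤ + k) * b - (1ℤ + n) * (b - a) ≡ (1ℤ + k) * a
  identity = solve-∀

-- The alternating sum and the Stirling sum

C-pascal : ∀ n k → + (suc n C suc k) ≡ + (n C k) + + (n C suc k)
C-pascal n k = cong +_ (sym (C.nCk+nC[k+1]≡[n+1]C[k+1] n k))

opaque
  binomialSum : ℕ → (ℕ → ℤ) → ℤ
  binomialSum n g = ∑ (upTo (suc n)) (λ i → + (n C i) * g i)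

  binomialSum-zero : ∀ g → binomialSum 0 g ≡ g 0
  binomialSum-zero g = trans (∑-upTo-last 0 _)
    (trans (cong (_+ 1ℤ * g 0) (∑-[] _)) (trans (ℤ.+-identityˡ _) (ℤ.*-identityˡ (g 0))))

  binomialSum-unfold : ∀ n g → binomialSum n g ≡ ∑ (upTo (suc n)) (λ i → + (n C i) * g i)
  binomialSum-unfold n g = refl

  -- With E the shift, `binomialSum n g` is (1 + E)^n g at 0, and Pascal's rule peels off one factor
  -- 1 + E.
  binomialSum-suc : ∀ n g → binomialSum (suc n) g ≡ binomialSum n g + binomialSum n (g ∘ suc)
  binomialSum-suc n g = begin
    binomialSum (suc n) g
      ≡⟨ ∑-upTo-suc (suc n) _ ⟩
    1ℤ * g 0 + ∑ (upTo (suc n)) (λ i → + (suc n C suc i) * g (suc i))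
      ≡⟨ cong (λ s → 1ℤ * g 0 + s) (∑-cong (upTo (suc n)) split) ⟩
    1ℤ * g 0 + ∑ (upTo (suc n)) (λ i → + (n C i) * g (suc i) + + (n C suc i) * g (suc i))
      ≡⟨ cong (λ s → 1ℤ * g 0 + s) (∑-+ (upTo (suc n)) _ _) ⟩
    1ℤ * g 0 + (binomialSum n (g ∘ suc) + tail)
      ≡⟨ rearrange (1ℤ * g 0) (binomialSum n (g ∘ suc)) tail ⟩
    (1ℤ * g 0 + tail) + binomialSum n (g ∘ suc)
      ≡⟨ cong (_+ binomialSum n (g ∘ suc)) (sym (∑-upTo-suc (suc n) (λ i → + (n C i) * g i))) ⟩
    ∑ (upTo (suc (suc n))) (λ i → + (n C i) * g i) + binomialSum n (g ∘ suc)
      ≡⟨ cong (_+ binomialSum n (g ∘ suc)) (∑-upTo-last (suc n) (λ i → + (n C i) * g i)) ⟩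
    binomialSum n g + + (n C suc n) * g (suc n) + binomialSum n (g ∘ suc)
      -- The surplus top term has index n + 1, where the binomial coefficient is zero.
      ≡⟨ cong (λ c → binomialSum n g + + c * g (suc n) + binomialSum n (g ∘ suc)) (C.k>n⇒nCk≡0 (ℕ.n<1+n n)) ⟩
    binomialSum n g + 0ℤ + binomialSum n (g ∘ suc)
      ≡⟨ cong (_+ binomialSum n (g ∘ suc)) (ℤ.+-identityʳ (binomialSum n g)) ⟩
    binomialSum n g + binomialSum n (g ∘ suc) ∎
    where
    tail : ℤ
    tail = ∑ (upTo (suc n)) (λ i → + (n C suc i) * g (suc i))
    split : ∀ i → + (suc n C suc i) * g (suc i) ≡ + (n C i) * g (suc i) + + (n C suc i) * g (suc i)
    split i = trans (cong (_* g (suc i)) (C-pascal n i)) (ℤ.*-distribʳ-+ (g (suc i)) (+ (n C i)) (+ (n C suc i)))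
    rearrange : ∀ a b c → a + (b + c) ≡ (a + c) + b
    rearrange = solve-∀

  binomialSum-cong : ∀ n {f g} → (∀ i → i ≤ n → f i ≡ g i) → binomialSum n f ≡ binomialSum n g
  binomialSum-cong n e = ∑-upTo-cong (suc n) (λ { i (s≤s i≤n) → cong (+ (n C i) *_) (e i i≤n) })

  binomialSum-+ : ∀ n f g → binomialSum n (λ i → f i + g i) ≡ binomialSum n f + binomialSum n g
  binomialSum-+ n f g = trans
    (∑-cong (upTo (suc n)) (λ i → ℤ.*-distribˡ-+ (+ (n C i)) (f i) (g i))) (∑-+ (upTo (suc n)) _ _)

  binomialSum-*ˡ : ∀ n c f → binomialSum n (λ i → c * f i) ≡ c * binomialSum n f
  binomialSum-*ˡ n c f = trans
    (∑-cong (upTo (suc n)) (λ i → exchange (+ (n C i)) c (f i))) (∑-*ˡ (upTo (suc n)) c _)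
    where
    exchange : ∀ a b c → a * (b * c) ≡ b * (a * c)
    exchange = solve-∀

-- This is Δ = E - 1 expanded binomially: peeling one factor leaves the sum at `y + 1ℤ` and the
-- negated sum at `y`.
Δ-binomialSum : ∀ k N y → Δ k N y ≡ binomialSum k (λ i → -1ℤ ^ i * ((y + (+ k - + i)) ^ N))
Δ-binomialSum zero    N y = sym (begin
  binomialSum 0 (λ i → -1ℤ ^ i * ((y + (0ℤ - + i)) ^ N)) ≡⟨ binomialSum-zero _ ⟩
  1ℤ * ((y + 0ℤ) ^ N)               ≡⟨ ℤ.*-identityˡ _ ⟩
  (y + 0ℤ) ^ N                      ≡⟨ cong (_^ N) (ℤ.+-identityʳ y) ⟩
  y ^ N                             ∎)
Δ-binomialSum (suc k) N y = sym (begin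
  binomialSum (suc k) g
    ≡⟨ binomialSum-suc k g ⟩
  binomialSum k g + binomialSum k (g ∘ suc)
    ≡⟨ cong₂ _+_ (binomialSum-cong k (λ i _ → cong (λ z → -1ℤ ^ i * (z ^ N)) (up y (+ k) (+ i))))
                 (trans (binomialSum-cong k (λ i _ → down i)) (binomialSum-*ˡ k -1ℤ _)) ⟩
  binomialSum k (λ i → -1ℤ ^ i * ((y + 1ℤ + (+ k - + i)) ^ N)) +
    -1ℤ * binomialSum k (λ i → -1ℤ ^ i * ((y + (+ k - + i)) ^ N))
    ≡⟨ cong₂ (λ a b → a + -1ℤ * b) (sym (Δ-binomialSum k N (y + 1ℤ))) (sym (Δ-binomialSum k N y)) ⟩
  Δ k N (y + 1ℤ) + -1ℤ * Δ k N y
    ≡⟨ cong (λ z → Δ k N (y + 1ℤ) + z) (ℤ.-1*i≡-i (Δ k N y)) ⟩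
  Δ (suc k) N y ∎)
  where
  g : ℕ → ℤ
  g i = -1ℤ ^ i * ((y + (+ suc k - + i)) ^ N)
  up : ∀ y k i → y + (1ℤ + k - i) ≡ y + 1ℤ + (k - i)
  up = solve-∀
  shift : ∀ y k i → y + (1ℤ + k - (1ℤ + i)) ≡ y + (k - i)
  shift = solve-∀
  down : ∀ i → g (suc i) ≡ -1ℤ * (-1ℤ ^ i * ((y + (+ k - + i)) ^ N))
  down i = trans (ℤ.*-assoc -1ℤ (-1ℤ ^ i) _)
    (cong (λ z → -1ℤ * (-1ℤ ^ i * (z ^ N))) (shift y (+ k) (+ i)))

opaque
  unfolding ∑

  foldr-map-∑ : ∀ (xs : List A) f → foldr _+_ 0ℤ (map f xs) ≡ ∑ xs f
  foldr-map-∑ []       f = refl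
  foldr-map-∑ (x ∷ xs) f = cong (_+_ (f x)) (foldr-map-∑ xs f)

rhs-Δ : ∀ n k → rhs n k ≡ Δ k n (+ n - + k)
rhs-Δ n k = begin
  rhs n k
    ≡⟨ foldr-map-∑ (upTo (suc k)) _ ⟩
  ∑ (upTo (suc k)) (λ i → -1ℤ ^ i * + (k C i) * ((+ n - + i) ^ n))
    ≡⟨ trans (∑-cong (upTo (suc k)) term) (sym (binomialSum-unfold k _)) ⟩
  binomialSum k (λ i → -1ℤ ^ i * ((+ n - + k + (+ k - + i)) ^ n))
    ≡⟨ sym (Δ-binomialSum k n (+ n - + k)) ⟩
  Δ k n (+ n - + k) ∎
  where
  telescope : ∀ n k i → n - i ≡ n - k + (k - i)
  telescope = solve-∀
  exchange : ∀ a b c → a * b * c ≡ b * (a * c)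
  exchange = solve-∀
  term : ∀ i → -1ℤ ^ i * + (k C i) * ((+ n - + i) ^ n)
             ≡ + (k C i) * (-1ℤ ^ i * ((+ n - + k + (+ k - + i)) ^ n))
  term i = trans (exchange (-1ℤ ^ i) (+ (k C i)) _)
    (cong (λ z → + (k C i) * (-1ℤ ^ i * (z ^ n))) (telescope (+ n) (+ k) (+ i)))

-- Counts the ways to partition a subset of [N] into r blocks and to colour the rest with x colours.
stirlingSum : ℕ → ℕ → ℤ → ℤ
stirlingSum r N x = binomialSum N (λ m → x ^ (N ∸ m) * + S₂ m r)

-- The new element is either coloured, giving a factor `x`, or joins the partitioned subset, whose
-- size becomes `suc m`.
stirlingSum-suc : ∀ r N x → stirlingSum r (suc N) x ≡
                  x * stirlingSum r N x + binomialSum N (λ m → x ^ (N ∸ m) * + S₂ (suc m) r)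
stirlingSum-suc r N x = begin
  stirlingSum r (suc N) x
    ≡⟨ binomialSum-suc N _ ⟩
  binomialSum N (λ m → x ^ (suc N ∸ m) * + S₂ m r) + second
    ≡⟨ cong (_+ second) (binomialSum-cong N pull) ⟩
  binomialSum N (λ m → x * (x ^ (N ∸ m) * + S₂ m r)) + second
    ≡⟨ cong (_+ second) (binomialSum-*ˡ N x _) ⟩
  x * stirlingSum r N x + second ∎
  where
  second = binomialSum N (λ m → x ^ (N ∸ m) * + S₂ (suc m) r)
  pull : ∀ m → m ≤ N → x ^ (suc N ∸ m) * + S₂ m r ≡ x * (x ^ (N ∸ m) * + S₂ m r)
  -- Truncated subtraction commutes with `suc` only for `m ≤ N`; this is why `binomialSum-cong`
  -- supplies the bound.
  pull m m≤N rewrite ℕ.+-∸-assoc 1 m≤N = ℤ.*-assoc x _ _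

-- For natural `x`, ordering the blocks gives the words of length N over r + x letters that use all
-- of r given letters. The proof matches recurrences instead: that of `S₂` becomes `Δ-leibniz′`.
stirlingSum-Δ : ∀ r N x → + (r !) * stirlingSum r N x ≡ Δ r N x
stirlingSum-Δ zero    zero    x = trans (ℤ.*-identityˡ _) (binomialSum-zero _)
stirlingSum-Δ (suc r) zero    x = begin
  + (suc r !) * stirlingSum (suc r) 0 x ≡⟨ cong (+ (suc r !) *_) (binomialSum-zero _) ⟩
  + (suc r !) * 0ℤ                     ≡⟨ ℤ.*-zeroʳ (+ (suc r !)) ⟩
  0ℤ                                   ≡⟨ sym (Δ-vanish (s≤s (z≤n {r})) x) ⟩
  Δ (suc r) zero x                     ∎
stirlingSum-Δ zero (suc N) x = begin
  1ℤ * stirlingSum 0 (suc N) x           ≡⟨ ℤ.*-identityˡ _ ⟩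
  stirlingSum 0 (suc N) x                ≡⟨ stirlingSum-suc 0 N x ⟩
  x * stirlingSum 0 N x + binomialSum N (λ m → x ^ (N ∸ m) * 0ℤ)
    ≡⟨ cong₂ _+_ (cong (x *_) (trans (sym (ℤ.*-identityˡ _)) (stirlingSum-Δ zero N x))) zeros ⟩
  x * x ^ N + 0ℤ                         ≡⟨ ℤ.+-identityʳ _ ⟩
  x * x ^ N                              ∎
  where
  zeros : binomialSum N (λ m → x ^ (N ∸ m) * 0ℤ) ≡ 0ℤ
  zeros = trans (binomialSum-cong N (λ m _ → ℤ.*-zeroʳ (x ^ (N ∸ m)))) (binomialSum-*ˡ N 0ℤ (λ _ → 0ℤ))
stirlingSum-Δ (suc r) (suc N) x = begin
  + (suc r !) * stirlingSum (suc r) (suc N) x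
    ≡⟨ cong (+ (suc r !) *_) (stirlingSum-suc (suc r) N x) ⟩
  + (suc r !) * (x * s + binomialSum N (λ m → x ^ (N ∸ m) * + S₂ (suc m) (suc r)))
    ≡⟨ cong (λ z → + (suc r !) * (x * s + z)) split ⟩
  + (suc r !) * (x * s + (+ suc r * s + s′))
    ≡⟨ cong (_* (x * s + (+ suc r * s + s′))) (ℤ.pos-* (suc r) (r !)) ⟩
  + suc r * + (r !) * (x * s + (+ suc r * s + s′))
    ≡⟨ expand (+ suc r) (+ (r !)) x s s′ ⟩
  (x + + suc r) * (+ suc r * + (r !) * s) + + suc r * (+ (r !) * s′)
    ≡⟨ cong (λ z → (x + + suc r) * (z * s) + + suc r * (+ (r !) * s′)) (sym (ℤ.pos-* (suc r) (r !))) ⟩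
  (x + + suc r) * (+ (suc r !) * s) + + suc r * (+ (r !) * s′)
    ≡⟨ cong₂ (λ a b → (x + + suc r) * a + + suc r * b) (stirlingSum-Δ (suc r) N x) (stirlingSum-Δ r N x) ⟩
  (x + + suc r) * Δ (suc r) N x + + suc r * Δ r N x
    ≡⟨ sym (Δ-leibniz′ r N x) ⟩
  Δ (suc r) (suc N) x ∎
  where
  s  = stirlingSum (suc r) N x
  s′ = stirlingSum r N x
  expand : ∀ k f x s s′ → k * f * (x * s + (k * s + s′)) ≡ (x + k) * (k * f * s) + k * (f * s′)
  expand = solve-∀
  distribute : ∀ p k a b → p * (k * a + b) ≡ k * (p * a) + p * b
  distribute = solve-∀
  S₂-suc : ∀ m → + S₂ (suc m) (suc r) ≡ + suc r * + S₂ m (suc r) + + S₂ m r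
  S₂-suc m = cong (_+ + S₂ m r) (ℤ.pos-* (suc r) (S₂ m (suc r)))
  split : binomialSum N (λ m → x ^ (N ∸ m) * + S₂ (suc m) (suc r)) ≡ + suc r * s + s′
  split = begin
    binomialSum N (λ m → x ^ (N ∸ m) * + S₂ (suc m) (suc r))
      ≡⟨ binomialSum-cong N (λ m _ → trans (cong (x ^ (N ∸ m) *_) (S₂-suc m))
           (distribute (x ^ (N ∸ m)) (+ suc r) (+ S₂ m (suc r)) (+ S₂ m r))) ⟩
    binomialSum N (λ m → + suc r * (x ^ (N ∸ m) * + S₂ m (suc r)) + x ^ (N ∸ m) * + S₂ m r)
      ≡⟨ binomialSum-+ N _ _ ⟩
    binomialSum N (λ m → + suc r * (x ^ (N ∸ m) * + S₂ m (suc r))) + s′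
      ≡⟨ cong (_+ s′) (binomialSum-*ˡ N (+ suc r) _) ⟩
    + suc r * s + s′ ∎

-- For j up to n + 1 both sides count j-subsets of n + 1 elements with a distinguished element
-- outside. Over ℤ the identity extends to larger j, where both binomial coefficients vanish.
C-absorb : ∀ n j → (+ suc n - + j) * + (suc n C j) ≡ + suc n * + (n C j)
C-absorb zero    zero          = refl
C-absorb zero    (suc zero)    = refl
C-absorb zero    (suc (suc j)) = trans
  (cong (λ c → (1ℤ - + suc (suc j)) * + c) (C.k>n⇒nCk≡0 {1} {suc (suc j)} (s≤s (s≤s z≤n))))
  (ℤ.*-zeroʳ (1ℤ - + suc (suc j)))
C-absorb (suc n) zero          = cong (_* 1ℤ) (ℤ.+-identityʳ (+ suc (suc n)))
C-absorb (suc n) (suc i)       = begin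
  (+ suc (suc n) - + suc i) * + (suc (suc n) C suc i)
    ≡⟨ cong (λ z → (+ suc (suc n) - + suc i) * z) (C-pascal (suc n) i) ⟩
  (+ suc (suc n) - + suc i) * (+ (suc n C i) + + (suc n C suc i))
    ≡⟨ split (+ suc n) (+ i) (+ (suc n C i)) (+ (suc n C suc i)) ⟩
  (+ suc n - + i) * + (suc n C i) + (+ suc n - + suc i) * + (suc n C suc i) + + (suc n C suc i)
    ≡⟨ cong₂ (λ a b → a + b + + (suc n C suc i)) (C-absorb n i) (C-absorb n (suc i)) ⟩
  + suc n * + (n C i) + + suc n * + (n C suc i) + + (suc n C suc i)
    ≡⟨ cong (_+ + (suc n C suc i)) (sym (ℤ.*-distribˡ-+ (+ suc n) (+ (n C i)) (+ (n C suc i)))) ⟩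
  + suc n * (+ (n C i) + + (n C suc i)) + + (suc n C suc i)
    ≡⟨ cong (λ z → + suc n * z + + (suc n C suc i)) (sym (C-pascal n i)) ⟩
  + suc n * + (suc n C suc i) + + (suc n C suc i)
    ≡⟨ collect (+ suc n) (+ (suc n C suc i)) ⟩
  + suc (suc n) * + (suc n C suc i) ∎
  where
  split : ∀ n i a b → (1ℤ + n - (1ℤ + i)) * (a + b) ≡ (n - i) * a + (n - (1ℤ + i)) * b + b
  split = solve-∀
  collect : ∀ n a → n * a + a ≡ (1ℤ + n) * a
  collect = solve-∀

S₂-vanish : ∀ {a b} → a < b → S₂ a b ≡ 0
S₂-vanish {zero}  {suc b} _         = refl
S₂-vanish {suc a} {suc b} (s≤s a<b)
  rewrite S₂-vanish (ℕ.m<n⇒m<1+n a<b) | S₂-vanish a<b | ℕ.*-zeroʳ b = refl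

opaque
  unfolding binomialSum

  binomialSum-suc-tail : ∀ n g → g 0 ≡ 0ℤ →
    binomialSum (suc n) g ≡ ∑ (upTo (suc n)) (λ m → + (suc n C suc m) * g (suc m))
  binomialSum-suc-tail n g g0 = trans (∑-upTo-suc (suc n) _)
    (trans (cong (λ z → 1ℤ * z + ∑ (upTo (suc n)) (λ m → + (suc n C suc m) * g (suc m))) g0) (ℤ.+-identityˡ _))

  binomialSum-tail : ∀ n g → g 0 ≡ 0ℤ →
    binomialSum n g ≡ ∑ (upTo (suc n)) (λ m → + (n C suc m) * g (suc m))
  binomialSum-tail n g g0 = begin
    binomialSum n g                             ≡⟨ sym (ℤ.+-identityʳ _) ⟩
    binomialSum n g + 0ℤ * g (suc n)
      ≡⟨ cong (λ c → binomialSum n g + + c * g (suc n)) (sym (C.k>n⇒nCk≡0 (ℕ.n<1+n n))) ⟩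
    binomialSum n g + + (n C suc n) * g (suc n) ≡⟨ sym (∑-upTo-last (suc n) _) ⟩
    ∑ (upTo (suc (suc n))) (λ i → + (n C i) * g i) ≡⟨ ∑-upTo-suc (suc n) _ ⟩
    1ℤ * g 0 + rest                             ≡⟨ cong (λ z → 1ℤ * z + rest) g0 ⟩
    0ℤ + rest                                   ≡⟨ ℤ.+-identityˡ rest ⟩
    rest ∎
    where
    rest : ℤ
    rest = ∑ (upTo (suc n)) (λ m → + (n C suc m) * g (suc m))

pos-∸ : ∀ {m n} → n ≤ m → + (m ∸ n) ≡ + m - + n
pos-∸ {m} {n} n≤m = sym (trans (ℤ.m-n≡m⊖n m n) (ℤ.⊖-≥ n≤m))

pos-^ : ∀ a e → + (a ℕ.^ e) ≡ (+ a) ^ e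
pos-^ a zero    = refl
pos-^ a (suc e) = trans (ℤ.pos-* a (a ℕ.^ e)) (cong (+ a *_) (pos-^ a e))

-- Write m - k as (n - k) - (n - m); then `C-absorb` trades n - m times the binomial coefficient for
-- n + 1 times a smaller one.
factor-absorb : ∀ {n k m} → k ≤ m → m ≤ n → let x = + n - + k in
  + (suc n C suc m) * + factor n k m ≡
  + (suc n C suc m) * x ^ (n ∸ m) - + suc n * (+ (n C suc m) * x ^ (n ∸ suc m))
factor-absorb {n} {k} {m} k≤m m≤n with m ℕ.≡ᵇ n in eq
-- At m = n the conventional value 1 agrees with x^0, and `n C suc n` = 0 removes the subtracted
-- term.
... | true  with refl ← ℕ.≡ᵇ⇒≡ m n (subst T (sym eq) _)
  rewrite ℕ.n∸n≡0 n | C.k>n⇒nCk≡0 (ℕ.n<1+n n) | ℤ.*-zeroʳ (+ suc n) = sym (ℤ.+-identityʳ _)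
... | false = begin
  c * + ((n ∸ k) ℕ.^ (n ∸ m ∸ 1) ℕ.* (m ∸ k))
    ≡⟨ cong (c *_) (ℤ.pos-* ((n ∸ k) ℕ.^ (n ∸ m ∸ 1)) (m ∸ k)) ⟩
  c * (+ ((n ∸ k) ℕ.^ (n ∸ m ∸ 1)) * + (m ∸ k))
    ≡⟨ cong₂ (λ a b → c * (a * b)) (pos-^ (n ∸ k) (n ∸ m ∸ 1)) (pos-∸ k≤m) ⟩
  c * ((+ (n ∸ k)) ^ (n ∸ m ∸ 1) * (+ m - + k))
    ≡⟨ cong₂ (λ a e → c * (a ^ e * (+ m - + k))) (pos-∸ (ℕ.≤-trans k≤m m≤n)) (ℕ.∸-+-assoc n m 1) ⟩
  c * (x ^ (n ∸ (m ℕ.+ 1)) * (+ m - + k))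
    ≡⟨ cong (λ e → c * (x ^ (n ∸ e) * (+ m - + k))) (ℕ.+-comm m 1) ⟩
  c * (p * (+ m - + k))
    ≡⟨ split c (+ n) (+ m) (+ k) p ⟩
  c * (x * p) - (+ suc n - + suc m) * c * p
    ≡⟨ cong₂ (λ a b → c * a - b * p) (cong (x ^_) (sym n∸m)) (C-absorb n (suc m)) ⟩
  c * x ^ (n ∸ m) - + suc n * + (n C suc m) * p
    ≡⟨ cong (λ z → c * x ^ (n ∸ m) - z) (ℤ.*-assoc (+ suc n) (+ (n C suc m)) p) ⟩
  c * x ^ (n ∸ m) - + suc n * (+ (n C suc m) * p) ∎
  where
  x = + n - + k
  c = + (suc n C suc m)
  p = x ^ (n ∸ suc m)
  m<n : m < n
  m<n = ℕ.≤∧≢⇒< m≤n (λ m≡n → subst T eq (ℕ.≡⇒≡ᵇ m n m≡n))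
  n∸m : n ∸ m ≡ suc (n ∸ suc m)
  n∸m = ℕ.+-∸-assoc 1 m<n
  split : ∀ c n m k p → c * (p * (m - k)) ≡ c * ((n - k) * p) - (1ℤ + n - (1ℤ + m)) * c * p
  split = solve-∀

opaque
  unfolding ∑

  sum-map-∑ : ∀ (xs : List A) f → + ℕ.sum (map f xs) ≡ ∑ xs (λ x → + f x)
  sum-map-∑ []       f = refl
  sum-map-∑ (x ∷ xs) f = cong (_+_ (+ f x)) (sum-map-∑ xs f)

lhs-≤ : ∀ n k → k ≤ n → + lhs n k ≡ Δ k n (+ n - + k)
-- The factor k + 1 completes `k !` to `suc k !`, as `stirlingSum-Δ` requires for k + 1 blocks.
lhs-≤ n k k≤n = ℤ.*-cancelˡ-≡ (+ suc k) _ _ (begin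
  + suc k * + lhs n k
    ≡⟨ cong (+ suc k *_) unfolded ⟩
  + suc k * (+ (k !) * (stirlingSum (suc k) (suc n) x - + suc n * stirlingSum (suc k) n x))
    ≡⟨ expand (+ suc k) (+ (k !)) (stirlingSum (suc k) (suc n) x) (+ suc n) (stirlingSum (suc k) n x) ⟩
  + suc k * + (k !) * stirlingSum (suc k) (suc n) x - + suc n * (+ suc k * + (k !) * stirlingSum (suc k) n x)
    ≡⟨ cong (λ z → z * stirlingSum (suc k) (suc n) x - + suc n * (z * stirlingSum (suc k) n x))
         (sym (ℤ.pos-* (suc k) (k !))) ⟩
  + (suc k !) * stirlingSum (suc k) (suc n) x - + suc n * (+ (suc k !) * stirlingSum (suc k) n x)
    ≡⟨ cong₂ (λ a b → a - + suc n * b) (stirlingSum-Δ (suc k) (suc n) x) (stirlingSum-Δ (suc k) n x) ⟩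
  Δ (suc k) (suc n) x - + suc n * Δ (suc k) n x
    ≡⟨ Δ-difference n k ⟩
  + suc k * Δ k n x ∎)
  where
  x = + n - + k
  expand : ∀ a f s n t → a * (f * (s - n * t)) ≡ a * f * s - n * (a * f * t)
  expand = solve-∀
  F : ℕ → ℕ
  F m = (suc n C suc m) ℕ.* S₂ (suc m) (suc k) ℕ.* (k !) ℕ.* factor n k m
  g g′ : ℕ → ℤ
  g  m = x ^ (suc n ∸ m) * + S₂ m (suc k)
  g′ m = x ^ (n ∸ m) * + S₂ m (suc k)
  G : ℕ → ℤ
  G m = + (k !) * (+ (suc n C suc m) * g (suc m) - + suc n * (+ (n C suc m) * g′ (suc m)))
  reorder : ∀ c s f h → c * s * f * h ≡ f * ((c * h) * s)
  reorder = solve-∀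
  distribute : ∀ f c p n d q s → f * ((c * p - n * (d * q)) * s) ≡ f * (c * (p * s) - n * (d * (q * s)))
  distribute = solve-∀
  vanish : ∀ f c p n d q → f * (c * (p * 0ℤ) - n * (d * (q * 0ℤ))) ≡ 0ℤ
  vanish = solve-∀
  FG : ∀ m → k ≤ m → m ≤ n → + F m ≡ G m
  FG m k≤m m≤n = begin
    + F m
      ≡⟨ ℤ.pos-* (c ℕ.* s ℕ.* (k !)) _ ⟩
    + (c ℕ.* s ℕ.* (k !)) * + factor n k m
      ≡⟨ cong (_* + factor n k m) (trans (ℤ.pos-* (c ℕ.* s) (k !)) (cong (_* + (k !)) (ℤ.pos-* c s))) ⟩
    + c * + s * + (k !) * + factor n k m
      ≡⟨ reorder (+ c) (+ s) (+ (k !)) (+ factor n k m) ⟩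
    + (k !) * (+ c * + factor n k m * + s)
      ≡⟨ cong (λ z → + (k !) * (z * + s)) (factor-absorb k≤m m≤n) ⟩
    + (k !) * ((+ c * x ^ (n ∸ m) - + suc n * (+ (n C suc m) * x ^ (n ∸ suc m))) * + s)
      ≡⟨ distribute (+ (k !)) (+ c) (x ^ (n ∸ m)) (+ suc n) (+ (n C suc m)) (x ^ (n ∸ suc m)) (+ s) ⟩
    G m ∎
    where
    c = suc n C suc m
    s = S₂ (suc m) (suc k)
  G-vanish : ∀ m → m < k → G m ≡ 0ℤ
  G-vanish m m<k = trans
    (cong (λ s → + (k !) * (+ (suc n C suc m) * (x ^ (n ∸ m) * + s)
                            - + suc n * (+ (n C suc m) * (x ^ (n ∸ suc m) * + s))))
      (S₂-vanish (s≤s m<k)))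
    (vanish (+ (k !)) (+ (suc n C suc m)) (x ^ (n ∸ m)) (+ suc n) (+ (n C suc m)) (x ^ (n ∸ suc m)))
  unfolded : + lhs n k ≡ + (k !) * (stirlingSum (suc k) (suc n) x - + suc n * stirlingSum (suc k) n x)
  unfolded = begin
    + lhs n k
      ≡⟨ sum-map-∑ (upTo (suc n ∸ k)) (λ i → F (k ℕ.+ i)) ⟩
    ∑ (upTo (suc n ∸ k)) (λ i → + F (k ℕ.+ i))
      ≡⟨ ∑-upTo-cong (suc n ∸ k) (λ i i<d → FG (k ℕ.+ i) (ℕ.m≤m+n k i)
           (ℕ.s≤s⁻¹ (subst (suc (k ℕ.+ i) ≤_) (ℕ.m+[n∸m]≡n (ℕ.m≤n⇒m≤1+n k≤n)) (ℕ.+-monoʳ-< k i<d)))) ⟩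
    ∑ (upTo (suc n ∸ k)) (λ i → G (k ℕ.+ i))
      ≡⟨ sym (ℤ.+-identityˡ _) ⟩
    0ℤ + ∑ (upTo (suc n ∸ k)) (λ i → G (k ℕ.+ i))
      -- Terms with m < k contain S(m+1, k+1) = 0, so the summation may start at m = 0.
      ≡⟨ cong (_+ ∑ (upTo (suc n ∸ k)) (λ i → G (k ℕ.+ i)))
           (sym (trans (∑-upTo-cong k G-vanish) (∑-zero (upTo k)))) ⟩
    ∑ (upTo k) G + ∑ (upTo (suc n ∸ k)) (λ i → G (k ℕ.+ i))
      ≡⟨ sym (∑-upTo-+ k (suc n ∸ k) G) ⟩
    ∑ (upTo (k ℕ.+ (suc n ∸ k))) G
      ≡⟨ cong (λ l → ∑ (upTo l) G) (ℕ.m+[n∸m]≡n (ℕ.m≤n⇒m≤1+n k≤n)) ⟩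
    ∑ (upTo (suc n)) G
      ≡⟨ trans (∑-*ˡ (upTo (suc n)) (+ (k !)) _) (cong (+ (k !) *_) (∑-- (upTo (suc n)) _ _)) ⟩
    + (k !) * (∑ (upTo (suc n)) (λ m → + (suc n C suc m) * g (suc m))
               - ∑ (upTo (suc n)) (λ m → + suc n * (+ (n C suc m) * g′ (suc m))))
      ≡⟨ cong (λ z → + (k !) * (∑ (upTo (suc n)) (λ m → + (suc n C suc m) * g (suc m)) - z))
           (∑-*ˡ (upTo (suc n)) (+ suc n) _) ⟩
    + (k !) * (∑ (upTo (suc n)) (λ m → + (suc n C suc m) * g (suc m))
               - + suc n * ∑ (upTo (suc n)) (λ m → + (n C suc m) * g′ (suc m)))
      ≡⟨ cong₂ (λ a b → + (k !) * (a - + suc n * b))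
           (sym (binomialSum-suc-tail n g (ℤ.*-zeroʳ (x ^ suc n))))
           (sym (binomialSum-tail n g′ (ℤ.*-zeroʳ (x ^ n)))) ⟩
    + (k !) * (stirlingSum (suc k) (suc n) x - + suc n * stirlingSum (suc k) n x) ∎

lhs-Δ : ∀ n k → + lhs n k ≡ Δ k n (+ n - + k)
lhs-Δ n k with k ℕ.≤? n
... | yes k≤n = lhs-≤ n k k≤n
-- For k > n the sum is empty, and the order of the difference exceeds the exponent.
... | no  k≰n rewrite ℕ.m≤n⇒m∸n≡0 (ℕ.≰⇒> k≰n) = sym (Δ-vanish (ℕ.≰⇒> k≰n) _)

-- Functions covering a given set

remove : ∀ {n} → Fin n → (Fin n → Bool) → Fin n → Bool
remove x R j = R j ∧ not (does (x Fin.≟ j))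

size : ∀ {n} → (Fin n → Bool) → ℕ
size {n} R = count R (allFin n)

-- Letters are struck off the set still to be hit as the word is read, which makes the recursion on
-- the first letter definitional.
covers : ∀ {n N} → (Fin n → Bool) → Vec (Fin n) N → Bool
covers {n} R []      = all (not ∘ R) (allFin n)
covers     R (x ∷ f) = covers (remove x R) f

size-remove : ∀ {n} (R : Fin n → Bool) x → + size R ≡ + size (remove x R) + ⟦ R x ⟧
size-remove {n} R x = begin
  + size R
    ≡⟨ ∑-count R (allFin n) ⟩
  ∑ (allFin n) (⟦_⟧ ∘ R)
    ≡⟨ ∑-cong (allFin n) split ⟩
  ∑ (allFin n) (λ j → ⟦ remove x R j ⟧ + ⟦ does (x Fin.≟ j) ⟧ * ⟦ R j ⟧)
    ≡⟨ ∑-+ (allFin n) _ _ ⟩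
  ∑ (allFin n) (⟦_⟧ ∘ remove x R) + ∑ (allFin n) (λ j → ⟦ does (x Fin.≟ j) ⟧ * ⟦ R j ⟧)
    ≡⟨ cong₂ _+_ (sym (∑-count (remove x R) (allFin n))) (∑-sift x (⟦_⟧ ∘ R)) ⟩
  + size (remove x R) + ⟦ R x ⟧ ∎
  where
  split : ∀ j → ⟦ R j ⟧ ≡ ⟦ remove x R j ⟧ + ⟦ does (x Fin.≟ j) ⟧ * ⟦ R j ⟧
  split j with R j | does (x Fin.≟ j)
  ... | true  | true  = refl
  ... | true  | false = refl
  ... | false | true  = refl
  ... | false | false = refl

covers-[] : ∀ (R : A → Bool) xs y → ⟦ all (not ∘ R) xs ⟧ ≡ Δ (count R xs) 0 y
covers-[] R []       y = refl
covers-[] R (x ∷ xs) y with R x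
... | true  = sym (Δ-vanish {suc (count R xs)} (s≤s z≤n) y)
... | false = covers-[] R xs y

covers-Δ : ∀ {n} N (R : Fin n → Bool) →
           ∑ (allVecs (allFin n) N) (⟦_⟧ ∘ covers R) ≡ Δ (size R) N (+ n - + size R)
covers-Δ {n} zero    R = trans (∑-[-] [] _) (covers-[] R (allFin n) _)
covers-Δ {n} (suc N) R = begin
  ∑ (allVecs (allFin n) (suc N)) (⟦_⟧ ∘ covers R)
    ≡⟨ ∑-allVecs-suc (allFin n) N _ ⟩
  ∑ (allFin n) (λ x → ∑ (allVecs (allFin n) N) (⟦_⟧ ∘ covers (remove x R)))
    -- A first letter outside `R` leaves `a`; one inside leaves `b`, with one letter fewer to hit
    -- and the base point raised by one.
    ≡⟨ ∑-cong (allFin n) (λ x → trans (covers-Δ N (remove x R)) (step x)) ⟩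
  ∑ (allFin n) (λ x → a + ⟦ R x ⟧ * (b - a))
    ≡⟨ ∑-+ (allFin n) _ _ ⟩
  ∑ (allFin n) (λ _ → a) + ∑ (allFin n) (λ x → ⟦ R x ⟧ * (b - a))
    ≡⟨ cong₂ _+_ (∑-const n a) (∑-*ʳ (allFin n) (b - a) _) ⟩
  + n * a + ∑ (allFin n) (⟦_⟧ ∘ R) * (b - a)
    ≡⟨ cong (λ s → + n * a + s * (b - a)) (sym (∑-count R (allFin n))) ⟩
  + n * a + + r * (b - a)
    ≡⟨ rearrange (+ n) (+ r) a b ⟩
  (+ n - + r) * a + + r * b
    ≡⟨ sym (Δ-leibniz r N (+ n - + r)) ⟩
  Δ r (suc N) (+ n - + r) ∎
  where
  r : ℕ
  r = size R
  a b : ℤ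
  a = Δ r N (+ n - + r)
  b = Δ (ℕ.pred r) N (+ n - + r + 1ℤ)
  rearrange : ∀ n r a b → n * a + r * (b - a) ≡ (n - r) * a + r * b
  rearrange = solve-∀
  in-R : ∀ a b → b ≡ a + 1ℤ * (b - a)
  in-R = solve-∀
  out-R : ∀ a b → a ≡ a + 0ℤ * (b - a)
  out-R = solve-∀
  shift : ∀ n s → n - s ≡ n - (s + 1ℤ) + 1ℤ
  shift = solve-∀
  step : ∀ x → Δ (size (remove x R)) N (+ n - + size (remove x R)) ≡ a + ⟦ R x ⟧ * (b - a)
  step x with R x | size-remove R x
  ... | true  | e = trans
    (cong₂ (λ s y → Δ s N y)
      (sym (cong ℕ.pred (trans (ℤ.+-injective e) (ℕ.+-comm (size (remove x R)) 1))))
      (trans (shift (+ n) (+ size (remove x R))) (cong (λ s → + n - s + 1ℤ) (sym e))))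
    (in-R a b)
  ... | false | e = trans
    (cong (λ s → Δ s N (+ n - + s)) (sym (ℤ.+-injective (trans e (ℤ.+-identityʳ _)))))
    (out-R a b)

covers⁺ : ∀ {n N} (R : Fin n → Bool) (f : Vec (Fin n) N) →
          (∀ j → T (R j) → ∃ λ i → lookup f i ≡ j) → T (covers R f)
covers⁺ R [] h = all-allFin⁺ (not ∘ R) empty
  where
  empty : ∀ j → T (not (R j))
  empty j with R j in eq
  ... | false = _
  ... | true with () ← proj₁ (h j (subst T (sym eq) _))
covers⁺ R (x ∷ f) h = covers⁺ (remove x R) f h′
  where
  h′ : ∀ j → T (remove x R j) → ∃ λ i → lookup f i ≡ j
  h′ j t with x Fin.≟ j | to (T-∧ {R j}) t
  ... | no x≢j | Rj , _ with h j Rj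
  ...   | zero  , x≡j = contradiction x≡j x≢j
  ...   | suc i , e   = i , e

covers⁻ : ∀ {n N} (R : Fin n → Bool) (f : Vec (Fin n) N) →
          T (covers R f) → ∀ j → T (R j) → ∃ λ i → lookup f i ≡ j
covers⁻ R []      t j Rj with R j | all-allFin⁻ (not ∘ R) t j
... | true | ()
covers⁻ R (x ∷ f) t j Rj with x Fin.≟ j in eq
... | yes x≡j = zero , x≡j
... | no  x≢j with i , e ← covers⁻ (remove x R) f t j
                  (from (T-∧ {R j}) (Rj , subst (λ d → T (not (does d))) (sym eq) _)) = suc i , e

-- For k > n the left side is false while the right side asks only for surjectivity, hence the
-- bound.
coversK-covers : ∀ {n k} → k ≤ n → (f : Vec (Fin n) n) →
                 coversK k f ≡ covers (λ j → toℕ j ℕ.<ᵇ k) f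
coversK-covers {n} {k} k≤n f = T-ext
  (λ t → covers⁺ below f λ j j<k → forth j j<k (all-allFin⁻ _ (proj₂ (to (T-∧ {k ℕ.≤ᵇ n}) t)) j))
  (λ t → from (T-∧ {k ℕ.≤ᵇ n}) (ℕ.≤⇒≤ᵇ k≤n , all-allFin⁺ _ (back t)))
  where
  below : Fin n → Bool
  below j = toℕ j ℕ.<ᵇ k
  hit : Fin n → Bool
  hit j = any (λ i → toℕ (lookup f i) ℕ.≡ᵇ toℕ j) (allFin n)
  forth : ∀ j → T (below j) → T (if below j then hit j else true) → ∃ λ i → lookup f i ≡ j
  forth j j<k t with below j
  ... | true with i , e ← any-allFin⁻ _ t = i , Fin.toℕ-injective (ℕ.≡ᵇ⇒≡ _ _ e)
  back : T (covers below f) → ∀ j → T (if below j then hit j else true)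
  back t j with below j in eq
  ... | false = _
  ... | true with i , e ← covers⁻ below f t j (subst T (sym eq) _) =
    any-allFin⁺ _ i (ℕ.≡⇒≡ᵇ _ _ (cong toℕ e))

size-below : ∀ {n k} → k ≤ n → + size {n} (λ j → toℕ j ℕ.<ᵇ k) ≡ + k
size-below {n} {k} k≤n = trans (∑-count _ (allFin n)) (sum-below k≤n)
  where
  sum-below : ∀ {n k} → k ≤ n → ∑ (allFin n) (λ j → ⟦ toℕ j ℕ.<ᵇ k ⟧) ≡ + k
  sum-below {n} z≤n = ∑-zero (allFin n)
  sum-below (s≤s k≤n) = trans (∑-allFin-suc _) (cong (_+_ 1ℤ) (sum-below k≤n))

cardF-Δ : ∀ n k → + cardF n k ≡ Δ k n (+ n - + k)
cardF-Δ n k with k ℕ.≤? n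
... | yes k≤n = begin
  + cardF n k
    ≡⟨ ∑-count (coversK k) _ ⟩
  ∑ (allVecs (allFin n) n) (⟦_⟧ ∘ coversK k)
    ≡⟨ ∑-cong _ (λ f → cong ⟦_⟧ (coversK-covers k≤n f)) ⟩
  ∑ (allVecs (allFin n) n) (⟦_⟧ ∘ covers (λ j → toℕ j ℕ.<ᵇ k))
    ≡⟨ covers-Δ n _ ⟩
  Δ (size {n} (λ j → toℕ j ℕ.<ᵇ k)) n (+ n - + size {n} (λ j → toℕ j ℕ.<ᵇ k))
    ≡⟨ cong (λ s → Δ s n (+ n - + s)) (ℤ.+-injective (size-below k≤n)) ⟩
  Δ k n (+ n - + k) ∎
... | no k≰n = begin
  + cardF n k                                  ≡⟨ ∑-count (coversK k) _ ⟩
  ∑ (allVecs (allFin n) n) (⟦_⟧ ∘ coversK k)   ≡⟨ ∑-zero-cong _ (λ f → cong ⟦_⟧ (uncovered f)) ⟩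
  0ℤ                                           ≡⟨ sym (Δ-vanish (ℕ.≰⇒> k≰n) _) ⟩
  Δ k n (+ n - + k) ∎
  where
  uncovered : ∀ f → coversK k f ≡ false
  uncovered f = T-ext {b = false}
    (λ t → k≰n (ℕ.≤ᵇ⇒≤ k n (proj₁ (to (T-∧ {k ℕ.≤ᵇ n}) t)))) λ ()

-- Weighted sums over rooted forests

targets : ∀ n → List (Maybe (Fin n))
targets n = allMaybe (allFin n)

isEq : ∀ {n} → Maybe (Fin n) → Maybe (Fin n) → Bool
isEq s t = does (Maybe.≡-dec Fin._≟_ s t)

∑-targets : ∀ {n} f → ∑ (targets n) f ≡ f nothing + ∑ (allFin n) (f ∘ just)
∑-targets {n} f = trans (∑-∷ nothing _ f) (cong (_+_ (f nothing)) (∑-map just (allFin n) f))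

∑-targets-suc : ∀ {n} f → ∑ (targets (suc n)) f ≡ f (just zero) + ∑ (targets n) (f ∘ Maybe.map suc)
∑-targets-suc {n} f = begin
  ∑ (targets (suc n)) f
    ≡⟨ ∑-targets f ⟩
  f nothing + ∑ (allFin (suc n)) (f ∘ just)
    ≡⟨ cong (_+_ (f nothing)) (∑-allFin-suc _) ⟩
  f nothing + (f (just zero) + ∑ (allFin n) (f ∘ just ∘ suc))
    ≡⟨ exchange (f nothing) (f (just zero)) _ ⟩
  f (just zero) + (f nothing + ∑ (allFin n) (f ∘ just ∘ suc))
    ≡⟨ cong (_+_ (f (just zero))) (sym (∑-targets (f ∘ Maybe.map suc))) ⟩
  f (just zero) + ∑ (targets n) (f ∘ Maybe.map suc) ∎
  where
  exchange : ∀ a b c → a + (b + c) ≡ b + (a + c)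
  exchange = solve-∀

∑-targets-sift : ∀ {n} (t : Maybe (Fin n)) (f : Maybe (Fin n) → ℤ) →
                 ∑ (targets n) (λ e → ⟦ isEq t e ⟧ * f e) ≡ f t
∑-targets-sift {n} nothing  f = begin
  ∑ (targets n) (λ e → ⟦ isEq nothing e ⟧ * f e)          ≡⟨ ∑-targets _ ⟩
  1ℤ * f nothing + ∑ (allFin n) (λ u → 0ℤ * f (just u))
    ≡⟨ cong₂ _+_ (ℤ.*-identityˡ (f nothing)) (∑-zero-cong (allFin n) (λ u → ℤ.*-zeroˡ (f (just u)))) ⟩
  f nothing + 0ℤ                                          ≡⟨ ℤ.+-identityʳ _ ⟩
  f nothing ∎
∑-targets-sift {n} (just v) f = begin
  ∑ (targets n) (λ e → ⟦ isEq (just v) e ⟧ * f e)         ≡⟨ ∑-targets _ ⟩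
  0ℤ * f nothing + ∑ (allFin n) (λ u → ⟦ does (v Fin.≟ u) ⟧ * f (just u))
    ≡⟨ cong₂ _+_ (ℤ.*-zeroˡ (f nothing)) (∑-sift v (f ∘ just)) ⟩
  0ℤ + f (just v)                                         ≡⟨ ℤ.+-identityˡ _ ⟩
  f (just v) ∎

-- Elimination of vertex 0, all its children being handed to its parent.
redirect : ∀ {n} → Maybe (Fin n) → Maybe (Fin (suc n)) → Maybe (Fin n)
redirect t nothing        = nothing
redirect t (just zero)    = t
redirect t (just (suc u)) = just u

-- Eliminating a vertex of a longer cycle shortens the cycle, so each cycle ends as a loop at its
-- greatest vertex, and only loops at the current vertex have to be detected.
acyclic : ∀ {n} → Vec (Maybe (Fin n)) n → Bool
acyclic {zero}  []                 = true
acyclic {suc n} (nothing ∷ p)      = acyclic (Vec.map (redirect nothing) p)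
acyclic {suc n} (just zero ∷ p)    = false
acyclic {suc n} (just (suc u) ∷ p) = acyclic (Vec.map (redirect (just u)) p)

acyclic-∷ : ∀ {n} (t : Maybe (Fin n)) p →
            acyclic (Maybe.map suc t ∷ p) ≡ acyclic (Vec.map (redirect t) p)
acyclic-∷ nothing  p = refl
acyclic-∷ (just u) p = refl

weight : ∀ {m} → (Fin m → A → ℤ) → Vec A m → ℤ
weight w []      = 1ℤ
weight w (x ∷ p) = w zero x * weight (w ∘ suc) p

-- The pushforward of each row of weights along `redirect t`.
push : ∀ {m n} → Maybe (Fin n) → (Fin m → Maybe (Fin (suc n)) → ℤ) → Fin m → Maybe (Fin n) → ℤ
push t w v e = w v (Maybe.map suc e) + ⟦ isEq t e ⟧ * w v (just zero)

∑-redirect : ∀ {n} (t : Maybe (Fin n)) (c : Maybe (Fin (suc n)) → ℤ) (h : Maybe (Fin n) → ℤ) →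
  ∑ (targets (suc n)) (λ x → c x * h (redirect t x)) ≡
  ∑ (targets n) (λ e → (c (Maybe.map suc e) + ⟦ isEq t e ⟧ * c (just zero)) * h e)
∑-redirect {n} t c h = begin
  ∑ (targets (suc n)) (λ x → c x * h (redirect t x))
    ≡⟨ ∑-targets-suc _ ⟩
  c (just zero) * h t + ∑ (targets n) (λ e → c (Maybe.map suc e) * h (redirect t (Maybe.map suc e)))
    ≡⟨ cong (_+_ (c (just zero) * h t))
         (∑-cong (targets n) (λ e → cong (λ z → c (Maybe.map suc e) * h z) (keep e))) ⟩
  c (just zero) * h t + ∑ (targets n) (λ e → c (Maybe.map suc e) * h e)
    ≡⟨ cong (_+ _) (sym (∑-targets-sift t (λ e → c (just zero) * h e))) ⟩
  ∑ (targets n) (λ e → ⟦ isEq t e ⟧ * (c (just zero) * h e)) + ∑ (targets n) (λ e → c (Maybe.map suc e) * h e)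
    ≡⟨ sym (∑-+ (targets n) _ _) ⟩
  ∑ (targets n) (λ e → ⟦ isEq t e ⟧ * (c (just zero) * h e) + c (Maybe.map suc e) * h e)
    ≡⟨ ∑-cong (targets n) (λ e → collect ⟦ isEq t e ⟧ (c (just zero)) (h e) (c (Maybe.map suc e))) ⟩
  ∑ (targets n) (λ e → (c (Maybe.map suc e) + ⟦ isEq t e ⟧ * c (just zero)) * h e) ∎
  where
  keep : ∀ e → redirect t (Maybe.map suc e) ≡ e
  keep nothing  = refl
  keep (just u) = refl
  collect : ∀ i z h c → i * (z * h) + c * h ≡ (c + i * z) * h
  collect = solve-∀

-- Rows are chosen independently, so the pushforward acts row by row. The test function `h` is
-- arbitrary so that the induction can fix its first entry.
∑-weight-redirect : ∀ {n} m (w : Fin m → Maybe (Fin (suc n)) → ℤ) t (h : Vec (Maybe (Fin n)) m → ℤ) →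
  ∑ (allVecs (targets (suc n)) m) (λ p → weight w p * h (Vec.map (redirect t) p)) ≡
  ∑ (allVecs (targets n) m) (λ q → weight (push t w) q * h q)
∑-weight-redirect zero    w t h = trans (∑-[-] [] _) (sym (∑-[-] [] _))
∑-weight-redirect {n} (suc m) w t h = begin
  ∑ (allVecs (targets (suc n)) (suc m)) (λ p → weight w p * h (Vec.map (redirect t) p))
    ≡⟨ ∑-allVecs-suc (targets (suc n)) m _ ⟩
  ∑ (targets (suc n)) (λ x → ∑ (allVecs (targets (suc n)) m) (λ p →
    w zero x * weight (w ∘ suc) p * h (redirect t x ∷ Vec.map (redirect t) p)))
    ≡⟨ ∑-cong (targets (suc n)) (λ x → trans
         (∑-cong _ (λ p → ℤ.*-assoc (w zero x) (weight (w ∘ suc) p) _)) (trans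
         (∑-*ˡ _ (w zero x) _)
         (cong (w zero x *_) (∑-weight-redirect m (w ∘ suc) t (λ q → h (redirect t x ∷ q)))))) ⟩
  ∑ (targets (suc n)) (λ x → w zero x * rest (redirect t x))
    ≡⟨ ∑-redirect t (w zero) rest ⟩
  ∑ (targets n) (λ e → push t w zero e * rest e)
    ≡⟨ ∑-cong (targets n) (λ e → trans (sym (∑-*ˡ _ (push t w zero e) _))
         (∑-cong _ (λ q → sym (ℤ.*-assoc (push t w zero e) (weight (push t (w ∘ suc)) q) _)))) ⟩
  ∑ (targets n) (λ e → ∑ (allVecs (targets n) m) (λ q →
    push t w zero e * weight (push t (w ∘ suc)) q * h (e ∷ q)))
    ≡⟨ sym (∑-allVecs-suc (targets n) m _) ⟩
  ∑ (allVecs (targets n) (suc m)) (λ q → weight (push t w) q * h q) ∎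
  where
  rest : Maybe (Fin n) → ℤ
  rest e = ∑ (allVecs (targets n) m) (λ q → weight (push t (w ∘ suc)) q * h (e ∷ q))

-- By the matrix-tree theorem this is det(D - W), where W holds the weights between vertices and D
-- is the diagonal matrix of row totals, `nothing` included.
forestSum : ∀ {n} → (Fin n → Maybe (Fin n) → ℤ) → ℤ
forestSum {n} w = ∑ (allVecs (targets n) n) (λ p → weight w p * ⟦ acyclic p ⟧)

forestSum-suc : ∀ {n} (w : Fin (suc n) → Maybe (Fin (suc n)) → ℤ) →
  forestSum w ≡ ∑ (targets n) (λ t → w zero (Maybe.map suc t) * forestSum (push t (w ∘ suc)))
forestSum-suc {n} w = begin
  forestSum w
    ≡⟨ ∑-allVecs-suc (targets (suc n)) n _ ⟩
  ∑ (targets (suc n)) (λ x → ∑ ps (λ p → w zero x * weight (w ∘ suc) p * ⟦ acyclic (x ∷ p) ⟧))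
    ≡⟨ ∑-targets-suc _ ⟩
  ∑ ps (λ p → w zero (just zero) * weight (w ∘ suc) p * 0ℤ) +
    ∑ (targets n) (λ t →
      ∑ ps (λ p → w zero (Maybe.map suc t) * weight (w ∘ suc) p * ⟦ acyclic (Maybe.map suc t ∷ p) ⟧))
    -- Vertex 0 as its own parent contributes zero, because `acyclic` rejects the loop.
    ≡⟨ cong₂ _+_ (∑-zero-cong ps (λ p → ℤ.*-zeroʳ (w zero (just zero) * weight (w ∘ suc) p)))
                 (∑-cong (targets n) eliminate) ⟩
  0ℤ + ∑ (targets n) (λ t → w zero (Maybe.map suc t) * forestSum (push t (w ∘ suc)))
    ≡⟨ ℤ.+-identityˡ _ ⟩
  ∑ (targets n) (λ t → w zero (Maybe.map suc t) * forestSum (push t (w ∘ suc))) ∎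
  where
  ps : List (Vec (Maybe (Fin (suc n))) n)
  ps = allVecs (targets (suc n)) n
  eliminate : ∀ t →
    ∑ ps (λ p → w zero (Maybe.map suc t) * weight (w ∘ suc) p * ⟦ acyclic (Maybe.map suc t ∷ p) ⟧) ≡
    w zero (Maybe.map suc t) * forestSum (push t (w ∘ suc))
  eliminate t = begin
    ∑ ps (λ p → w zero (Maybe.map suc t) * weight (w ∘ suc) p * ⟦ acyclic (Maybe.map suc t ∷ p) ⟧)
      ≡⟨ ∑-cong ps (λ p → trans
           (cong (λ z → w zero (Maybe.map suc t) * weight (w ∘ suc) p * ⟦ z ⟧) (acyclic-∷ t p))
           (ℤ.*-assoc (w zero (Maybe.map suc t)) _ _)) ⟩
    ∑ ps (λ p → w zero (Maybe.map suc t) * (weight (w ∘ suc) p * ⟦ acyclic (Vec.map (redirect t) p) ⟧))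
      ≡⟨ ∑-*ˡ ps (w zero (Maybe.map suc t)) _ ⟩
    w zero (Maybe.map suc t) * ∑ ps (λ p → weight (w ∘ suc) p * ⟦ acyclic (Vec.map (redirect t) p) ⟧)
      ≡⟨ cong (w zero (Maybe.map suc t) *_) (∑-weight-redirect n (w ∘ suc) t (⟦_⟧ ∘ acyclic)) ⟩
    w zero (Maybe.map suc t) * forestSum (push t (w ∘ suc)) ∎

-- Products and triangular weights

∏ : ∀ {n} → (Fin n → ℤ) → ℤ
∏ {zero}  b = 1ℤ
∏ {suc n} b = b zero * ∏ (b ∘ suc)

∏-except : ∀ {n} → (Fin n → ℤ) → Fin n → ℤ
∏-except b zero    = ∏ (b ∘ suc)
∏-except b (suc u) = b zero * ∏-except (b ∘ suc) u

-- The derivative of ∏ b in the direction y.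
∂∏ : ∀ {n} → (Fin n → ℤ) → (Fin n → ℤ) → ℤ
∂∏ {n} y b = ∑ (allFin n) (λ u → y u * ∏-except b u)

∂∏-suc : ∀ {n} (y b : Fin (suc n) → ℤ) →
         ∂∏ y b ≡ y zero * ∏ (b ∘ suc) + b zero * ∂∏ (y ∘ suc) (b ∘ suc)
∂∏-suc {n} y b = trans (∑-allFin-suc _) (cong (_+_ (y zero * ∏ (b ∘ suc)))
  (trans (∑-cong (allFin n) (λ u → exchange (y (suc u)) (b zero) _)) (∑-*ˡ (allFin n) (b zero) _)))
  where
  exchange : ∀ a b c → a * (b * c) ≡ b * (a * c)
  exchange = solve-∀

-- In D - W, marked rows vanish on unmarked columns and are upper triangular on marked ones; the
-- unmarked block is a diagonal matrix minus one whose rows all equal `y`. Weights from unmarked to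
-- marked vertices are free. Extending `y` by zero gives one formula for both blocks.
record Triangular {n} (S : Fin n → Bool) (y : Fin n → ℤ) (w : Fin n → Maybe (Fin n) → ℤ) : Set where
  field
    unmarked      : ∀ {v u} → S v ≡ false → S u ≡ false → w v (just u) ≡ y u
    y-marked      : ∀ {u} → S u ≡ true → y u ≡ 0ℤ
    marked-leave  : ∀ {v u} → S v ≡ true → S u ≡ false → w v (just u) ≡ 0ℤ
    marked-ascend : ∀ {v u} → S v ≡ true → toℕ u ≤ toℕ v → w v (just u) ≡ 0ℤ

  diagonal : ∀ v → w v (just v) ≡ y v
  diagonal v with S v in eq
  ... | true  = trans (marked-ascend eq ℕ.≤-refl) (sym (y-marked eq))
  ... | false = unmarked eq eq

module _ {n} {S : Fin (suc n) → Bool} {y : Fin (suc n) → ℤ} {w : Fin (suc n) → Maybe (Fin (suc n)) → ℤ}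
         (tri : Triangular S y w) where
  open Triangular tri

  extra : Maybe (Fin n) → Fin n → ℤ
  extra t u = ⟦ isEq t (just u) ⟧ * (⟦ not (S (suc u)) ⟧ * y zero)

  -- A marked vertex 0 may carry arbitrary weights from unmarked vertices, and handing these to an
  -- unmarked `t` would spoil its constant column; hence the condition on `t`.
  push-triangular : ∀ t → (∀ {u} → t ≡ just u → S zero ≡ true → S (suc u) ≡ true) →
                    Triangular (S ∘ suc) (λ u → y (suc u) + extra t u) (push t (w ∘ suc))
  push-triangular t closed = record
    { unmarked      = λ Sv Su → cong₂ _+_ (unmarked Sv Su) (moved Sv Su)
    ; y-marked      = λ {u} Su → trans
                        (cong₂ (λ a b → a + ⟦ isEq t (just u) ⟧ * (⟦ not b ⟧ * y zero)) (y-marked Su) Su)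
                        (vanish ⟦ isEq t (just u) ⟧ (y zero))
    ; marked-leave  = λ {v} {u} Sv Su → no-weight t v u Sv (marked-leave Sv Su)
    ; marked-ascend = λ {v} {u} Sv u≤v → no-weight t v u Sv (marked-ascend Sv (s≤s u≤v))
    }
    where
    vanish : ∀ i z → 0ℤ + i * (0ℤ * z) ≡ 0ℤ
    vanish = solve-∀
    vanish′ : ∀ i → 0ℤ + i * 0ℤ ≡ 0ℤ
    vanish′ = solve-∀
    no-weight : ∀ t v u → S (suc v) ≡ true → w (suc v) (just (suc u)) ≡ 0ℤ →
                push t (w ∘ suc) v (just u) ≡ 0ℤ
    -- Label 0 is the least, so a marked vertex gives it no weight and passes nothing on to `t`.
    no-weight t v u Sv e = trans
      (cong₂ (λ a b → a + ⟦ isEq t (just u) ⟧ * b) e (marked-ascend Sv z≤n)) (vanish′ ⟦ isEq t (just u) ⟧)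
    moved : ∀ {v u} → S (suc v) ≡ false → S (suc u) ≡ false →
            ⟦ isEq t (just u) ⟧ * w (suc v) (just zero) ≡ extra t u
    moved {v} {u} Sv Su with Maybe.≡-dec Fin._≟_ t (just u)
    ... | no  _   = refl
    ... | yes t≡u with S zero in S0
    ...   | true  = contradiction (trans (sym (closed t≡u refl)) Su) λ ()
    ...   | false rewrite Su = cong (1ℤ *_) (trans (unmarked Sv S0) (sym (ℤ.*-identityˡ (y zero))))

  -- For a parent v of vertex 0 both contributions vanish if v or 0 is marked; otherwise the weight
  -- from 0 to v is `y` at v.
  ∑-extra : ∀ (c : Fin n → ℤ) →
    ∑ (targets n) (λ t → w zero (Maybe.map suc t) * ∑ (allFin n) (λ u → extra t u * c u)) ≡
    y zero * ∑ (allFin n) (λ u → y (suc u) * c u)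
  ∑-extra c = begin
    ∑ (targets n) (λ t → w zero (Maybe.map suc t) * ∑ (allFin n) (λ u → extra t u * c u))
      ≡⟨ ∑-targets _ ⟩
    w zero nothing * ∑ (allFin n) (λ u → extra nothing u * c u) +
      ∑ (allFin n) (λ v → w zero (just (suc v)) * ∑ (allFin n) (λ u → extra (just v) u * c u))
      ≡⟨ cong₂ _+_
           (trans (cong (w zero nothing *_)
                    (∑-zero-cong (allFin n) (λ u → vanish (⟦ not (S (suc u)) ⟧ * y zero) (c u))))
             (ℤ.*-zeroʳ (w zero nothing)))
           (∑-cong (allFin n) (λ v → trans (cong (w zero (just (suc v)) *_) (sift v)) (simplify v))) ⟩
    0ℤ + ∑ (allFin n) (λ v → y zero * (y (suc v) * c v))
      ≡⟨ trans (ℤ.+-identityˡ _) (∑-*ˡ (allFin n) (y zero) _) ⟩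
    y zero * ∑ (allFin n) (λ u → y (suc u) * c u) ∎
    where
    vanish : ∀ a c → 0ℤ * a * c ≡ 0ℤ
    vanish = solve-∀
    sift : ∀ v → ∑ (allFin n) (λ u → extra (just v) u * c u) ≡ ⟦ not (S (suc v)) ⟧ * y zero * c v
    sift v = trans (∑-cong (allFin n) (λ u → ℤ.*-assoc ⟦ does (v Fin.≟ u) ⟧ (⟦ not (S (suc u)) ⟧ * y zero) (c u)))
      (∑-sift v (λ u → ⟦ not (S (suc u)) ⟧ * y zero * c u))
    on-marked : ∀ a z c → a * (0ℤ * z * c) ≡ z * (0ℤ * c)
    on-marked = solve-∀
    from-marked : ∀ a b c → a * (1ℤ * 0ℤ * c) ≡ 0ℤ * (b * c)
    from-marked = solve-∀
    on-unmarked : ∀ a z c → a * (1ℤ * z * c) ≡ z * (a * c)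
    on-unmarked = solve-∀
    simplify : ∀ v → w zero (just (suc v)) * (⟦ not (S (suc v)) ⟧ * y zero * c v) ≡ y zero * (y (suc v) * c v)
    simplify v with S (suc v) in Sv | S zero in S0
    ... | true  | _     = trans (on-marked (w zero (just (suc v))) (y zero) (c v))
                            (cong (λ z → y zero * (z * c v)) (sym (y-marked Sv)))
    ... | false | true  = trans (cong (λ z → w zero (just (suc v)) * (1ℤ * z * c v)) (y-marked S0))
                            (trans (from-marked (w zero (just (suc v))) (y (suc v)) (c v))
                              (cong (_* (y (suc v) * c v)) (sym (y-marked S0))))
    ... | false | false = trans (on-unmarked (w zero (just (suc v))) (y zero) (c v))
                            (cong (λ z → y zero * (z * c v)) (unmarked S0 Sv))

-- A pushforward preserves total mass: this is `∑-redirect` with test function 1.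
∑-push : ∀ {m n} t (w : Fin m → Maybe (Fin (suc n)) → ℤ) v →
         ∑ (targets n) (push t w v) ≡ ∑ (targets (suc n)) (w v)
∑-push {n = n} t w v = begin
  ∑ (targets n) (push t w v)                       ≡⟨ ∑-cong (targets n) (λ e → sym (ℤ.*-identityʳ (push t w v e))) ⟩
  ∑ (targets n) (λ e → push t w v e * 1ℤ)          ≡⟨ sym (∑-redirect t (w v) (λ _ → 1ℤ)) ⟩
  ∑ (targets (suc n)) (λ x → w v x * 1ℤ)           ≡⟨ ∑-cong (targets (suc n)) (λ x → ℤ.*-identityʳ (w v x)) ⟩
  ∑ (targets (suc n)) (w v) ∎

-- As a determinant: the diagonal product of the marked block times the rank-one update formula for
-- the unmarked block. The proof eliminates vertex 0: row totals persist, `y` grows by `extra`, and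
-- linearity of `∂∏` in its direction isolates that correction.
forestSum-triangular : ∀ {n} (S : Fin n → Bool) y w → Triangular S y w →
  ∀ b → (∀ v → ∑ (targets n) (w v) ≡ b v) → forestSum w ≡ ∏ b - ∂∏ y b
forestSum-triangular {zero}  S y w tri b rows = begin
  forestSum w             ≡⟨ ∑-[-] [] _ ⟩
  1ℤ - 0ℤ                 ≡⟨ cong (_-_ 1ℤ) (sym (∑-[] _)) ⟩
  ∏ b - ∂∏ y b            ∎
forestSum-triangular {suc n} S y w tri b rows = begin
  forestSum w
    ≡⟨ forestSum-suc w ⟩
  ∑ (targets n) (λ t → w₀ t * forestSum (push t (w ∘ suc)))
    ≡⟨ ∑-cong (targets n) (λ t → trans (reduce t) (split (w₀ t) (∏ b′) (∂∏ y′ b′) (correction t))) ⟩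
  ∑ (targets n) (λ t → w₀ t * (∏ b′ - ∂∏ y′ b′) - w₀ t * correction t)
    ≡⟨ ∑-- (targets n) _ _ ⟩
  ∑ (targets n) (λ t → w₀ t * (∏ b′ - ∂∏ y′ b′)) - ∑ (targets n) (λ t → w₀ t * correction t)
    ≡⟨ cong₂ _-_ (∑-*ʳ (targets n) (∏ b′ - ∂∏ y′ b′) w₀) (∑-extra tri (∏-except b′)) ⟩
  ∑ (targets n) w₀ * (∏ b′ - ∂∏ y′ b′) - y zero * ∂∏ y′ b′
    -- Excluding vertex 0 as its own parent lowers its row total by the diagonal weight `y zero`.
    ≡⟨ cong (λ z → z * (∏ b′ - ∂∏ y′ b′) - y zero * ∂∏ y′ b′) row₀ ⟩
  (b zero - y zero) * (∏ b′ - ∂∏ y′ b′) - y zero * ∂∏ y′ b′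
    ≡⟨ collect (b zero) (y zero) (∏ b′) (∂∏ y′ b′) ⟩
  b zero * ∏ b′ - (y zero * ∏ b′ + b zero * ∂∏ y′ b′)
    ≡⟨ cong (λ z → b zero * ∏ b′ - z) (sym (∂∏-suc y b)) ⟩
  ∏ b - ∂∏ y b ∎
  where
  open Triangular tri
  w₀ : Maybe (Fin n) → ℤ
  w₀ t = w zero (Maybe.map suc t)
  y′ b′ : Fin n → ℤ
  y′ = y ∘ suc
  b′ = b ∘ suc
  correction : Maybe (Fin n) → ℤ
  correction t = ∑ (allFin n) (λ u → extra tri t u * ∏-except b′ u)
  split : ∀ a p d c → a * (p - (d + c)) ≡ a * (p - d) - a * c
  split = solve-∀
  collect : ∀ b y p d → (b - y) * (p - d) - y * d ≡ b * p - (y * p + b * d)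
  collect = solve-∀
  row₀ : ∑ (targets n) w₀ ≡ b zero - y zero
  row₀ = begin
    ∑ (targets n) w₀                                        ≡⟨ cancel (w zero (just zero)) (∑ (targets n) w₀) ⟩
    w zero (just zero) + ∑ (targets n) w₀ - w zero (just zero)
      ≡⟨ cong₂ _-_ (trans (sym (∑-targets-suc (w zero))) (rows zero)) (diagonal zero) ⟩
    b zero - y zero ∎
    where
    cancel : ∀ a s → s ≡ a + s - a
    cancel = solve-∀
  by-induction : ∀ t → (∀ {u} → t ≡ just u → S zero ≡ true → S (suc u) ≡ true) →
                 forestSum (push t (w ∘ suc)) ≡ ∏ b′ - (∂∏ y′ b′ + correction t)
  by-induction t closed = trans
    (forestSum-triangular (S ∘ suc) _ (push t (w ∘ suc)) (push-triangular tri t closed) b′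
      (λ v → trans (∑-push t (w ∘ suc) v) (rows (suc v))))
    (cong (_-_ (∏ b′)) (trans
      (∑-cong (allFin n) (λ u → ℤ.*-distribʳ-+ (∏-except b′ u) (y′ u) (extra tri t u)))
      (∑-+ (allFin n) _ _)))
  reduce : ∀ t → w₀ t * forestSum (push t (w ∘ suc)) ≡ w₀ t * (∏ b′ - (∂∏ y′ b′ + correction t))
  reduce nothing  = cong (w₀ nothing *_) (by-induction nothing λ ())
  reduce (just u) with S zero in S0 | S (suc u) in Su
  ... | true  | false = trans (cong (_* forestSum (push (just u) (w ∘ suc))) (marked-leave S0 Su))
                          (trans (ℤ.*-zeroˡ (forestSum (push (just u) (w ∘ suc))))
                            (trans (sym (ℤ.*-zeroˡ (∏ b′ - (∂∏ y′ b′ + correction (just u)))))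
                            (cong (_* (∏ b′ - (∂∏ y′ b′ + correction (just u)))) (sym (marked-leave S0 Su)))))
  ... | true  | true  = cong (w₀ (just u) *_) (by-induction (just u) λ { refl _ → Su })
  ... | false | _     = cong (w₀ (just u) *_) (by-induction (just u) λ _ S0′ → contradiction (trans (sym S0′) S0) λ ())

-- Summation over the candidates for the maximal decreasing subtree

ones : ∀ {N} → Vec Bool N → ℕ
ones []          = 0
ones (true  ∷ M) = suc (ones M)
ones (false ∷ M) = ones M

zeros : ∀ {N} → Vec Bool N → ℤ
zeros []          = 0ℤ
zeros (true  ∷ M) = zeros M
zeros (false ∷ M) = zeros M + 1ℤ

ones+zeros : ∀ {N} (M : Vec Bool N) → + ones M + zeros M ≡ + N
ones+zeros []          = refl
ones+zeros (true  ∷ M) = trans (ℤ.+-assoc 1ℤ (+ ones M) (zeros M)) (cong (_+_ 1ℤ) (ones+zeros M))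
ones+zeros (false ∷ M) = trans (shift (+ ones M) (zeros M)) (cong (_+_ 1ℤ) (ones+zeros M))
  where
  shift : ∀ a b → a + (b + 1ℤ) ≡ 1ℤ + (a + b)
  shift = solve-∀

∑-ones : ∀ {N} (M : Vec Bool N) → ∑ (allFin N) (λ u → ⟦ lookup M u ⟧) ≡ + ones M
∑-ones []          = ∑-[] _
∑-ones (true  ∷ M) = trans (∑-allFin-suc _) (cong (_+_ 1ℤ) (∑-ones M))
∑-ones (false ∷ M) = trans (∑-allFin-suc _) (trans (ℤ.+-identityˡ _) (∑-ones M))

∑-zeros : ∀ {N} (M : Vec Bool N) → ∑ (allFin N) (λ u → ⟦ not (lookup M u) ⟧) ≡ zeros M
∑-zeros []          = ∑-[] _
∑-zeros (true  ∷ M) = trans (∑-allFin-suc _) (trans (ℤ.+-identityˡ _) (∑-zeros M))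
∑-zeros (false ∷ M) = trans (∑-allFin-suc _) (trans (cong (_+_ 1ℤ) (∑-zeros M)) (ℤ.+-comm 1ℤ (zeros M)))

isTop : ∀ {N} → Vec Bool N → Fin N → Bool
isTop (m ∷ M) zero    = m ∧ (ones M ℕ.≡ᵇ 0)
isTop (m ∷ M) (suc v) = isTop M v

-- The parents that v may have when M is the vertex set of the maximal decreasing subtree.
allowed : ∀ {N} → Vec Bool N → Fin N → Maybe (Fin N) → Bool
allowed M v nothing  = isTop M v
allowed M v (just u) = if lookup M v
  then lookup M u ∧ (toℕ v ℕ.<ᵇ toℕ u)
  else (not (lookup M u) ∨ (toℕ u ℕ.<ᵇ toℕ v))

-- The number of allowed parents, with the number of unmarked vertices replaced by a parameter `c`.
-- An unmarked vertex has `c` plus the number of smaller marked ones; a marked vertex has the number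
-- of greater marked ones, or 1 if it is the greatest and may be the root. A free `c` can be shifted
-- along `M` and differentiated.
rowTotal : ∀ {N} → ℤ → Vec Bool N → Fin N → ℤ
rowTotal c (true  ∷ M) zero    = + (1 ⊔ ones M)
rowTotal c (false ∷ M) zero    = c
rowTotal c (true  ∷ M) (suc v) = rowTotal (c + 1ℤ) M v
rowTotal c (false ∷ M) (suc v) = rowTotal c M v

rowTotal-+1 : ∀ {N} c (M : Vec Bool N) v →
              rowTotal (c + 1ℤ) M v ≡ ⟦ not (lookup M v) ⟧ + rowTotal c M v
rowTotal-+1 c (true  ∷ M) zero    = refl
rowTotal-+1 c (false ∷ M) zero    = ℤ.+-comm c 1ℤ
rowTotal-+1 c (true  ∷ M) (suc v) = rowTotal-+1 (c + 1ℤ) M v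
rowTotal-+1 c (false ∷ M) (suc v) = rowTotal-+1 c M v

-- Whether or not vertex 0 is marked, a later vertex may have it as parent exactly if that later
-- vertex is unmarked, which amounts to raising `c` by one.
∑-allowed : ∀ {N} (M : Vec Bool N) v →
            ∑ (targets N) (λ t → ⟦ allowed M v t ⟧) ≡ rowTotal (zeros M) M v
∑-allowed (true ∷ M) zero = begin
  ∑ (targets _) (λ t → ⟦ allowed (true ∷ M) zero t ⟧)
    ≡⟨ trans (∑-targets-suc _) (cong (_+_ 0ℤ) (∑-targets _)) ⟩
  0ℤ + (⟦ ones M ℕ.≡ᵇ 0 ⟧ + ∑ (allFin _) (λ u → ⟦ lookup M u ∧ true ⟧))
    ≡⟨ ℤ.+-identityˡ _ ⟩
  ⟦ ones M ℕ.≡ᵇ 0 ⟧ + ∑ (allFin _) (λ u → ⟦ lookup M u ∧ true ⟧)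
    ≡⟨ cong (_+_ ⟦ ones M ℕ.≡ᵇ 0 ⟧) (trans (∑-cong (allFin _) (λ u → ∧-true (lookup M u))) (∑-ones M)) ⟩
  ⟦ ones M ℕ.≡ᵇ 0 ⟧ + + ones M
    ≡⟨ at-least-one (ones M) ⟩
  + (1 ⊔ ones M) ∎
  where
  ∧-true : ∀ b → ⟦ b ∧ true ⟧ ≡ ⟦ b ⟧
  ∧-true true  = refl
  ∧-true false = refl
  at-least-one : ∀ r → ⟦ r ℕ.≡ᵇ 0 ⟧ + + r ≡ + (1 ⊔ r)
  at-least-one zero    = refl
  at-least-one (suc r) = refl
∑-allowed (false ∷ M) zero = begin
  ∑ (targets _) (λ t → ⟦ allowed (false ∷ M) zero t ⟧)
    ≡⟨ trans (∑-targets-suc _) (cong (_+_ 1ℤ) (∑-targets _)) ⟩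
  1ℤ + (0ℤ + ∑ (allFin _) (λ u → ⟦ not (lookup M u) ∨ false ⟧))
    ≡⟨ cong (_+_ 1ℤ) (trans (ℤ.+-identityˡ _)
         (trans (∑-cong (allFin _) (λ u → ∨-false (not (lookup M u)))) (∑-zeros M))) ⟩
  1ℤ + zeros M
    ≡⟨ ℤ.+-comm 1ℤ (zeros M) ⟩
  zeros M + 1ℤ ∎
  where
  ∨-false : ∀ b → ⟦ b ∨ false ⟧ ≡ ⟦ b ⟧
  ∨-false true  = refl
  ∨-false false = refl
∑-allowed {suc N} (m ∷ M) (suc v) = begin
  ∑ (targets (suc N)) (λ t → ⟦ allowed (m ∷ M) (suc v) t ⟧)
    ≡⟨ ∑-targets-suc _ ⟩
  ⟦ allowed (m ∷ M) (suc v) (just zero) ⟧ + ∑ (targets N) (λ t → ⟦ allowed (m ∷ M) (suc v) (Maybe.map suc t) ⟧)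
    ≡⟨ cong₂ _+_ (to-zero m) (∑-cong (targets N) (λ t → cong ⟦_⟧ (to-suc t))) ⟩
  ⟦ not (lookup M v) ⟧ + ∑ (targets N) (λ t → ⟦ allowed M v t ⟧)
    ≡⟨ cong (_+_ ⟦ not (lookup M v) ⟧) (∑-allowed M v) ⟩
  ⟦ not (lookup M v) ⟧ + rowTotal (zeros M) M v
    ≡⟨ sym (rowTotal-+1 (zeros M) M v) ⟩
  rowTotal (zeros M + 1ℤ) M v
    ≡⟨ same-total m ⟩
  rowTotal (zeros (m ∷ M)) (m ∷ M) (suc v) ∎
  where
  to-zero : ∀ m → ⟦ allowed (m ∷ M) (suc v) (just zero) ⟧ ≡ ⟦ not (lookup M v) ⟧
  to-zero m with lookup M v | m
  ... | true  | true  = refl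
  ... | true  | false = refl
  ... | false | true  = refl
  ... | false | false = refl
  to-suc : ∀ t → allowed (m ∷ M) (suc v) (Maybe.map suc t) ≡ allowed M v t
  to-suc nothing  = refl
  to-suc (just u) = refl
  same-total : ∀ m → rowTotal (zeros M + 1ℤ) M v ≡ rowTotal (zeros (m ∷ M)) (m ∷ M) (suc v)
  same-total true  = refl
  same-total false = refl

unmarkedIndicator : ∀ {N} → Vec Bool N → Fin N → ℤ
unmarkedIndicator M u = ⟦ not (lookup M u) ⟧

allowed-triangular : ∀ {N} (M : Vec Bool N) →
  Triangular (lookup M) (unmarkedIndicator M) (λ v t → ⟦ allowed M v t ⟧)
allowed-triangular M = record
  { unmarked      = unmarked
  ; y-marked      = λ Mu → cong (⟦_⟧ ∘ not) Mu
  ; marked-leave  = marked-leave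
  ; marked-ascend = marked-ascend
  }
  where
  unmarked : ∀ {v u} → lookup M v ≡ false → lookup M u ≡ false →
             ⟦ allowed M v (just u) ⟧ ≡ unmarkedIndicator M u
  unmarked Mv Mu rewrite Mv | Mu = refl
  marked-leave : ∀ {v u} → lookup M v ≡ true → lookup M u ≡ false → ⟦ allowed M v (just u) ⟧ ≡ 0ℤ
  marked-leave Mv Mu rewrite Mv | Mu = refl
  marked-ascend : ∀ {v u} → lookup M v ≡ true → toℕ u ≤ toℕ v → ⟦ allowed M v (just u) ⟧ ≡ 0ℤ
  marked-ascend {v} {u} Mv u≤v with lookup M v | lookup M u
  ... | true | false = refl
  ... | true | true  = cong ⟦_⟧ (T-ext {toℕ v ℕ.<ᵇ toℕ u} {false}
    (λ v<u → ℕ.≤⇒≯ u≤v (ℕ.<ᵇ⇒< _ _ v<u)) λ ())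

bools : List Bool
bools = true ∷ false ∷ []

∑-bools-suc : ∀ N (f : Vec Bool (suc N) → ℤ) → ∑ (allVecs bools (suc N)) f ≡
              ∑ (allVecs bools N) (λ M → f (true ∷ M)) + ∑ (allVecs bools N) (λ M → f (false ∷ M))
∑-bools-suc N f = trans (∑-allVecs-suc bools N f) (trans (∑-∷ true _ g) (cong (_+_ (g true)) (∑-[-] false g)))
  where
  g : Bool → ℤ
  g m = ∑ (allVecs bools N) (λ M → f (m ∷ M))

at-ones : ∀ {N} r (M : Vec Bool N) (f : ℕ → ℤ) → ⟦ ones M ℕ.≡ᵇ r ⟧ * f (ones M) ≡ ⟦ ones M ℕ.≡ᵇ r ⟧ * f r
at-ones r M f with ones M ℕ.≡ᵇ r in eq
... | true  = cong (λ s → 1ℤ * f s) (ℕ.≡ᵇ⇒≡ _ _ (subst T (sym eq) _))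
... | false = trans (ℤ.*-zeroˡ (f (ones M))) (sym (ℤ.*-zeroˡ (f r)))

-- Sums over marked sets of given size

∏Sum : ℤ → ℕ → ℕ → ℤ
∏Sum c N r = ∑ (allVecs bools N) (λ M → ⟦ ones M ℕ.≡ᵇ r ⟧ * ∏ (rowTotal c M))

∂∏Sum : ℤ → ℕ → ℕ → ℤ
∂∏Sum c N r = ∑ (allVecs bools N) (λ M → ⟦ ones M ℕ.≡ᵇ r ⟧ * ∂∏ (unmarkedIndicator M) (rowTotal c M))

private
  pull-scalar : ∀ i c p → i * (c * p) ≡ c * (i * p)
  pull-scalar = solve-∀

  scale-ones : ∀ {N} r (g : Vec Bool N → ℤ) →
    ∑ (allVecs bools N) (λ M → ⟦ ones M ℕ.≡ᵇ r ⟧ * (+ (1 ⊔ ones M) * g M)) ≡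
    + (1 ⊔ r) * ∑ (allVecs bools N) (λ M → ⟦ ones M ℕ.≡ᵇ r ⟧ * g M)
  scale-ones r g = trans
    (∑-cong _ (λ M → trans (at-ones r M (λ s → + (1 ⊔ s) * g M))
      (pull-scalar ⟦ ones M ℕ.≡ᵇ r ⟧ (+ (1 ⊔ r)) (g M))))
    (∑-*ˡ _ (+ (1 ⊔ r)) _)

-- A marked vertex 0 with r marks after it has total `1 ⊔ r` and adds one to the total of each later
-- unmarked vertex; an unmarked one has total `c`.
∏Sum-suc : ∀ c N r → ∏Sum c (suc N) (suc r) ≡ + (1 ⊔ r) * ∏Sum (c + 1ℤ) N r + c * ∏Sum c N (suc r)
∏Sum-suc c N r = trans (∑-bools-suc N _) (cong₂ _+_
  (scale-ones r (λ M → ∏ (rowTotal (c + 1ℤ) M)))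
  (trans (∑-cong _ (λ M → pull-scalar ⟦ ones M ℕ.≡ᵇ suc r ⟧ c (∏ (rowTotal c M)))) (∑-*ˡ _ c _)))

∏Sum-suc-zero : ∀ c N → ∏Sum c (suc N) 0 ≡ c * ∏Sum c N 0
∏Sum-suc-zero c N = trans (∑-bools-suc N _) (trans (cong₂ _+_
  (∑-zero-cong _ (λ M → ℤ.*-zeroˡ (+ (1 ⊔ ones M) * ∏ (rowTotal (c + 1ℤ) M))))
  (trans (∑-cong _ (λ M → pull-scalar ⟦ ones M ℕ.≡ᵇ 0 ⟧ c (∏ (rowTotal c M)))) (∑-*ˡ _ c _)))
  (ℤ.+-identityˡ _))

private
  ∂-marked : ∀ a p k q → (0ℤ * p + k * q) * a ≡ a * (k * q)
  ∂-marked = solve-∀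

  ∂-unmarked : ∀ i p c q → i * (1ℤ * p + c * q) ≡ i * p + c * (i * q)
  ∂-unmarked = solve-∀

  ∑-∂∏-unmarked : ∀ c N r →
    ∑ (allVecs bools N) (λ M → ⟦ ones M ℕ.≡ᵇ r ⟧ * ∂∏ (unmarkedIndicator (false ∷ M)) (rowTotal c (false ∷ M)))
    ≡ ∏Sum c N r + c * ∂∏Sum c N r
  ∑-∂∏-unmarked c N r = trans
    (∑-cong _ (λ M → trans
      (cong (⟦ ones M ℕ.≡ᵇ r ⟧ *_) (∂∏-suc (unmarkedIndicator (false ∷ M)) (rowTotal c (false ∷ M))))
      (∂-unmarked ⟦ ones M ℕ.≡ᵇ r ⟧ (∏ (rowTotal c M)) c (∂∏ (unmarkedIndicator M) (rowTotal c M)))))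
    (trans (∑-+ _ _ _) (cong (_+_ (∏Sum c N r)) (∑-*ˡ _ c _)))

∂∏Sum-suc : ∀ c N r → ∂∏Sum c (suc N) (suc r) ≡
            + (1 ⊔ r) * ∂∏Sum (c + 1ℤ) N r + (∏Sum c N (suc r) + c * ∂∏Sum c N (suc r))
∂∏Sum-suc c N r = trans (∑-bools-suc N _) (cong₂ _+_
  (trans (∑-cong _ (λ M → trans
      (cong (⟦ ones M ℕ.≡ᵇ r ⟧ *_) (∂∏-suc (unmarkedIndicator (true ∷ M)) (rowTotal c (true ∷ M))))
      (trans (ℤ.*-comm ⟦ ones M ℕ.≡ᵇ r ⟧ _)
        (∂-marked ⟦ ones M ℕ.≡ᵇ r ⟧ (∏ (rowTotal (c + 1ℤ) M)) (+ (1 ⊔ ones M))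
          (∂∏ (unmarkedIndicator M) (rowTotal (c + 1ℤ) M))))))
    (scale-ones r (λ M → ∂∏ (unmarkedIndicator M) (rowTotal (c + 1ℤ) M))))
  (∑-∂∏-unmarked c N (suc r)))

∂∏Sum-suc-zero : ∀ c N → ∂∏Sum c (suc N) 0 ≡ ∏Sum c N 0 + c * ∂∏Sum c N 0
∂∏Sum-suc-zero c N = trans (∑-bools-suc N _) (trans (cong₂ _+_
  (∑-zero-cong _ (λ M → ℤ.*-zeroˡ (∂∏ (unmarkedIndicator (true ∷ M)) (rowTotal c (true ∷ M)))))
  (∑-∂∏-unmarked c N 0)) (ℤ.+-identityˡ _))

-- Multiplied by `suc r`, the two terms of `∏Sum-suc` become those of the Leibniz rule; the value 1
-- of `1 ⊔ 0` covers the empty marked set.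
∏Sum-Δ : ∀ c N r → + (1 ⊔ r) * ∏Sum c N r ≡ Δ r N c
∏Sum-Δ c zero    zero    = trans (ℤ.*-identityˡ _) (∑-[-] [] _)
∏Sum-Δ c zero    (suc r) = begin
  + suc r * ∏Sum c 0 (suc r)  ≡⟨ cong (+ suc r *_) (∑-[-] [] _) ⟩
  + suc r * 0ℤ                ≡⟨ ℤ.*-zeroʳ (+ suc r) ⟩
  0ℤ                          ≡⟨ sym (Δ-vanish (s≤s (z≤n {r})) c) ⟩
  Δ (suc r) 0 c               ∎
∏Sum-Δ c (suc N) zero    = begin
  1ℤ * ∏Sum c (suc N) 0      ≡⟨ cong (1ℤ *_) (∏Sum-suc-zero c N) ⟩
  1ℤ * (c * ∏Sum c N 0)      ≡⟨ pull-scalar 1ℤ c (∏Sum c N 0) ⟩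
  c * (1ℤ * ∏Sum c N 0)      ≡⟨ cong (c *_) (∏Sum-Δ c N 0) ⟩
  c * c ^ N                  ∎
∏Sum-Δ c (suc N) (suc r) = begin
  + suc r * ∏Sum c (suc N) (suc r)
    ≡⟨ cong (+ suc r *_) (∏Sum-suc c N r) ⟩
  + suc r * (+ (1 ⊔ r) * ∏Sum (c + 1ℤ) N r + c * ∏Sum c N (suc r))
    ≡⟨ expand (+ suc r) (+ (1 ⊔ r) * ∏Sum (c + 1ℤ) N r) c (∏Sum c N (suc r)) ⟩
  c * (+ suc r * ∏Sum c N (suc r)) + + suc r * (+ (1 ⊔ r) * ∏Sum (c + 1ℤ) N r)
    ≡⟨ cong₂ (λ a b → c * a + + suc r * b) (∏Sum-Δ c N (suc r)) (∏Sum-Δ (c + 1ℤ) N r) ⟩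
  c * Δ (suc r) N c + + suc r * Δ r N (c + 1ℤ)
    ≡⟨ sym (Δ-leibniz (suc r) N c) ⟩
  Δ (suc r) (suc N) c ∎
  where
  expand : ∀ s a c b → s * (a + c * b) ≡ c * (s * b) + s * a
  expand = solve-∀

∂∏Sum-zero : ∀ c r → ∂∏Sum c 0 r ≡ 0ℤ
∂∏Sum-zero c r = trans (∑-[-] [] _)
  (trans (cong (⟦ 0 ℕ.≡ᵇ r ⟧ *_) (∑-[] _)) (ℤ.*-zeroʳ ⟦ 0 ℕ.≡ᵇ r ⟧))

-- Only totals of unmarked vertices depend on `c`, each with slope 1, so `∂∏Sum` is the derivative
-- of `∏Sum` in `c`; differentiating t^(N+1) under Δ^r gives the factor N + 1. The induction obtains
-- this from the recurrences.
∂∏Sum-∏Sum : ∀ c N r → ∂∏Sum c (suc N) r ≡ + suc N * ∏Sum c N r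
∂∏Sum-∏Sum c zero zero = trans (∂∏Sum-suc-zero c 0)
  (trans (cong (λ z → ∏Sum c 0 0 + c * z) (∂∏Sum-zero c 0)) (identity (∏Sum c 0 0) c))
  where
  identity : ∀ a c → a + c * 0ℤ ≡ 1ℤ * a
  identity = solve-∀
∂∏Sum-∏Sum c zero (suc r) = trans (∂∏Sum-suc c 0 r)
  (trans (cong₂ (λ y z → + (1 ⊔ r) * y + (∏Sum c 0 (suc r) + c * z)) (∂∏Sum-zero (c + 1ℤ) r) (∂∏Sum-zero c (suc r)))
    (identity (+ (1 ⊔ r)) (∏Sum c 0 (suc r)) c))
  where
  identity : ∀ k a c → k * 0ℤ + (a + c * 0ℤ) ≡ 1ℤ * a
  identity = solve-∀
∂∏Sum-∏Sum c (suc N) zero = begin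
  ∂∏Sum c (suc (suc N)) 0                          ≡⟨ ∂∏Sum-suc-zero c (suc N) ⟩
  ∏Sum c (suc N) 0 + c * ∂∏Sum c (suc N) 0         ≡⟨ cong (λ z → ∏Sum c (suc N) 0 + c * z) (∂∏Sum-∏Sum c N 0) ⟩
  ∏Sum c (suc N) 0 + c * (+ suc N * ∏Sum c N 0)    ≡⟨ cong (_+_ (∏Sum c (suc N) 0)) (pull-scalar c (+ suc N) _) ⟩
  ∏Sum c (suc N) 0 + + suc N * (c * ∏Sum c N 0)    ≡⟨ cong (λ z → ∏Sum c (suc N) 0 + + suc N * z) (sym (∏Sum-suc-zero c N)) ⟩
  ∏Sum c (suc N) 0 + + suc N * ∏Sum c (suc N) 0    ≡⟨ sym (ℤ.suc-* (+ suc N) (∏Sum c (suc N) 0)) ⟩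
  + suc (suc N) * ∏Sum c (suc N) 0                 ∎
∂∏Sum-∏Sum c (suc N) (suc r) = begin
  ∂∏Sum c (suc (suc N)) (suc r)
    ≡⟨ ∂∏Sum-suc c (suc N) r ⟩
  k * ∂∏Sum (c + 1ℤ) (suc N) r + (h + c * ∂∏Sum c (suc N) (suc r))
    ≡⟨ cong₂ (λ y z → k * y + (h + c * z)) (∂∏Sum-∏Sum (c + 1ℤ) N r) (∂∏Sum-∏Sum c N (suc r)) ⟩
  k * (+ suc N * ∏Sum (c + 1ℤ) N r) + (h + c * (+ suc N * ∏Sum c N (suc r)))
    ≡⟨ collect k (+ suc N) (∏Sum (c + 1ℤ) N r) h c (∏Sum c N (suc r)) ⟩
  h + + suc N * (k * ∏Sum (c + 1ℤ) N r + c * ∏Sum c N (suc r))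
    ≡⟨ cong (λ z → h + + suc N * z) (sym (∏Sum-suc c N r)) ⟩
  h + + suc N * h
    ≡⟨ sym (ℤ.suc-* (+ suc N) h) ⟩
  + suc (suc N) * h ∎
  where
  k h : ℤ
  k = + (1 ⊔ r)
  h = ∏Sum c (suc N) (suc r)
  collect : ∀ k n a h c b → k * (n * a) + (h + c * (n * b)) ≡ h + n * (k * a + c * b)
  collect = solve-∀

∑-forests : ∀ n k →
  ∑ (allVecs bools (suc n)) (λ M → ⟦ ones M ℕ.≡ᵇ suc k ⟧ * forestSum (λ v t → ⟦ allowed M v t ⟧)) ≡
  Δ k n (+ n - + k)
-- The factor k + 1 clears the denominator in `∏Sum-Δ`.
∑-forests n k = ℤ.*-cancelˡ-≡ (+ suc k) _ _ (begin
  + suc k * ∑ (allVecs bools (suc n)) (λ M → ⟦ ones M ℕ.≡ᵇ suc k ⟧ * forestSum (λ v t → ⟦ allowed M v t ⟧))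
    ≡⟨ cong (+ suc k *_) (trans (∑-cong _ term) (∑-- _ _ _)) ⟩
  + suc k * (∏Sum c (suc n) (suc k) - ∂∏Sum c (suc n) (suc k))
    ≡⟨ cong (λ z → + suc k * (∏Sum c (suc n) (suc k) - z)) (∂∏Sum-∏Sum c n (suc k)) ⟩
  + suc k * (∏Sum c (suc n) (suc k) - + suc n * ∏Sum c n (suc k))
    ≡⟨ expand (+ suc k) (∏Sum c (suc n) (suc k)) (+ suc n) (∏Sum c n (suc k)) ⟩
  + suc k * ∏Sum c (suc n) (suc k) - + suc n * (+ suc k * ∏Sum c n (suc k))
    ≡⟨ cong₂ (λ a b → a - + suc n * b) (∏Sum-Δ c (suc n) (suc k)) (∏Sum-Δ c n (suc k)) ⟩
  Δ (suc k) (suc n) c - + suc n * Δ (suc k) n c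
    ≡⟨ Δ-difference n k ⟩
  + suc k * Δ k n c ∎)
  where
  c : ℤ
  c = + n - + k
  expand : ∀ a p n q → a * (p - n * q) ≡ a * p - n * (a * q)
  expand = solve-∀
  distribute : ∀ i p q → i * (p - q) ≡ i * p - i * q
  distribute = solve-∀
  determinant : Vec Bool (suc n) → ℤ → ℤ
  determinant M c = ∏ (rowTotal c M) - ∂∏ (unmarkedIndicator M) (rowTotal c M)
  cancel : ∀ a b → b ≡ a + b - a
  cancel = solve-∀
  simplify : ∀ n k → 1ℤ + n - (1ℤ + k) ≡ n - k
  simplify = solve-∀
  zeros-ones : ∀ M → zeros M ≡ + suc n - + ones M
  zeros-ones M = trans (cancel (+ ones M) (zeros M)) (cong (_- (+ ones M)) (ones+zeros M))
  term : ∀ M → ⟦ ones M ℕ.≡ᵇ suc k ⟧ * forestSum (λ v t → ⟦ allowed M v t ⟧) ≡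
               ⟦ ones M ℕ.≡ᵇ suc k ⟧ * ∏ (rowTotal c M)
               - ⟦ ones M ℕ.≡ᵇ suc k ⟧ * ∂∏ (unmarkedIndicator M) (rowTotal c M)
  term M = begin
    i * forestSum (λ v t → ⟦ allowed M v t ⟧)
      ≡⟨ cong (i *_) (forestSum-triangular _ _ _ (allowed-triangular M) _ (∑-allowed M)) ⟩
    i * determinant M (zeros M)
      ≡⟨ cong (λ z → i * determinant M z) (zeros-ones M) ⟩
    i * determinant M (+ suc n - + ones M)
      -- The parameter `zeros M` varies with `M`, but on the support of the indicator it equals n -
      -- k.
      ≡⟨ at-ones (suc k) M (λ s → determinant M (+ suc n - + s)) ⟩
    i * determinant M (+ suc n - + suc k)
      ≡⟨ cong (λ z → i * determinant M z) (simplify (+ n) (+ k)) ⟩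
    i * determinant M c
      ≡⟨ distribute i (∏ (rowTotal c M)) (∂∏ (unmarkedIndicator M) (rowTotal c M)) ⟩
    i * ∏ (rowTotal c M) - i * ∂∏ (unmarkedIndicator M) (rowTotal c M) ∎
    where
    i : ℤ
    i = ⟦ ones M ℕ.≡ᵇ suc k ⟧

-- Parent maps of trees

-- The path to a root as a derivation, free of the fuel in `reachesRoot`, so that proofs can recurse
-- on it.
data Reaches {N} (p : Vec (Maybe (Fin N)) N) (v : Fin N) : Set where
  root : lookup p v ≡ nothing → Reaches p v
  step : ∀ {u} → lookup p v ≡ just u → Reaches p u → Reaches p v

Rooted : ∀ {N} → Vec (Maybe (Fin N)) N → Set
Rooted p = ∀ v → Reaches p v

map-suc≢zero : ∀ {n} (t : Maybe (Fin n)) → Maybe.map suc t ≢ just (Fin.zero {n})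
map-suc≢zero nothing  ()
map-suc≢zero (just _) ()

module _ {n} (t : Maybe (Fin n)) (p : Vec (Maybe (Fin (suc n))) n) where

  private
    lookup-redirect : ∀ v {e} → lookup p v ≡ e → lookup (Vec.map (redirect t) p) v ≡ redirect t e
    lookup-redirect v e = trans (Vec.lookup-map v (redirect t) p) (cong (redirect t) e)

  -- The steps into and out of vertex 0 merge into one, or the path stops earlier if 0 was a root.
  -- The parent of 0 is not 0, so the merged step lands on a remaining vertex.
  reaches-redirect : ∀ {v} → Reaches (Maybe.map suc t ∷ p) (suc v) → Reaches (Vec.map (redirect t) p) v
  reaches-redirect {v} (root e)           = root (lookup-redirect v e)
  reaches-redirect {v} (step {suc u} e r) = step (lookup-redirect v e) (reaches-redirect r)
  reaches-redirect {v} (step {zero} e (root e₀)) =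
    root (trans (lookup-redirect v e) (Maybe.map-injective Fin.suc-injective e₀))
  reaches-redirect {v} (step {zero} e (step {suc u} e₀ r)) =
    step (trans (lookup-redirect v e) (Maybe.map-injective Fin.suc-injective e₀)) (reaches-redirect r)
  reaches-redirect {v} (step {zero} e (step {zero} e₀ r)) = contradiction e₀ (map-suc≢zero t)

  -- A step created by redirection expands into a step to 0 and the step out of 0.
  reaches-unredirect : ∀ {v} → Reaches (Vec.map (redirect t) p) v → Reaches (Maybe.map suc t ∷ p) (suc v)
  reaches-unredirect {v} (root e) with lookup p v in eq
  ... | nothing       = root eq
  ... | just zero     = step eq (root (cong (Maybe.map suc) (trans (sym (lookup-redirect v eq)) e)))
  ... | just (suc u)  with () ← trans (sym (lookup-redirect v eq)) e
  reaches-unredirect {v} (step e r) with lookup p v in eq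
  ... | nothing       with () ← trans (sym (lookup-redirect v eq)) e
  ... | just zero     = step eq (step (cong (Maybe.map suc) (trans (sym (lookup-redirect v eq)) e)) (reaches-unredirect r))
  ... | just (suc u)  with refl ← trans (sym (lookup-redirect v eq)) e = step eq (reaches-unredirect r)

  rooted-redirect : Rooted (Maybe.map suc t ∷ p) → Rooted (Vec.map (redirect t) p)
  rooted-redirect reach v = reaches-redirect (reach (suc v))

  rooted-unredirect : Rooted (Vec.map (redirect t) p) → Rooted (Maybe.map suc t ∷ p)
  rooted-unredirect reach (suc v) = reaches-unredirect (reach v)
  rooted-unredirect reach zero    = from-zero t refl
    where
    from-zero : ∀ s → t ≡ s → Reaches (Maybe.map suc t ∷ p) zero
    from-zero nothing  e = root (cong (Maybe.map suc) e)
    from-zero (just u) e = step (cong (Maybe.map suc) e) (reaches-unredirect (reach u))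

-- A derivation at a looping vertex would contain a smaller one at the same vertex, without end.
no-loop : ∀ {N} {p : Vec (Maybe (Fin N)) N} {v} → lookup p v ≡ just v → ¬ Reaches p v
no-loop loop (root e) with () ← trans (sym loop) e
no-loop loop (step e r) with refl ← trans (sym loop) e = no-loop loop r

acyclic⁺ : ∀ {N} (p : Vec (Maybe (Fin N)) N) → Rooted p → T (acyclic p)
acyclic⁺ []                 reach = tt
acyclic⁺ (nothing ∷ p)      reach = acyclic⁺ _ (rooted-redirect nothing p reach)
acyclic⁺ (just zero ∷ p)    reach = no-loop refl (reach zero)
acyclic⁺ (just (suc u) ∷ p) reach = acyclic⁺ _ (rooted-redirect (just u) p reach)

acyclic⁻ : ∀ {N} (p : Vec (Maybe (Fin N)) N) → T (acyclic p) → Rooted p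
acyclic⁻ (nothing ∷ p)      t = rooted-unredirect nothing p (acyclic⁻ _ t)
acyclic⁻ (just (suc u) ∷ p) t = rooted-unredirect (just u) p (acyclic⁻ _ t)

-- Depth and sufficient fuel

module _ {N} {p : Vec (Maybe (Fin N)) N} where

  depth : ∀ {v} → Reaches p v → ℕ
  depth (root _)   = 0
  depth (step _ r) = suc (depth r)

  depth-unique : ∀ {v} (r s : Reaches p v) → depth r ≡ depth s
  depth-unique (root _)   (root _)    = refl
  depth-unique (root e)   (step e′ _) with () ← trans (sym e) e′
  depth-unique (step e _) (root e′)   with () ← trans (sym e) e′
  depth-unique (step e r) (step e′ s) with refl ← trans (sym e) e′ = cong suc (depth-unique r s)

  path : ∀ {v} (r : Reaches p v) → Fin (suc (depth r)) → Fin N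
  path {v} r          zero    = v
  path     (step _ r) (suc i) = path r i

  path-reaches : ∀ {v} (r : Reaches p v) i → ∃ λ (s : Reaches p (path r i)) → toℕ i ℕ.+ depth s ≡ depth r
  path-reaches r          zero    = r , refl
  path-reaches (step _ r) (suc i) with s , e ← path-reaches r i = s , cong suc e

  -- Depth decreases by one at each position, and by `depth-unique` it is determined by the vertex,
  -- so equal vertices have equal positions.
  path-injective : ∀ {v} (r : Reaches p v) {i j} → path r i ≡ path r j → i ≡ j
  path-injective r {i} {j} eq with s , e ← path-reaches r i | s′ , e′ ← path-reaches r j =
    Fin.toℕ-injective (ℕ.+-cancelʳ-≡ (depth s) (toℕ i) (toℕ j)
      (trans e (trans (sym e′) (cong (toℕ j ℕ.+_) (sym same-depth)))))
    where
    same-depth : depth s ≡ depth s′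
    same-depth = trans (transport eq s) (depth-unique (subst (Reaches p) eq s) s′)
      where
      transport : ∀ {a b} (e : a ≡ b) (s : Reaches p a) → depth s ≡ depth (subst (Reaches p) e s)
      transport refl s = refl

  -- Pigeonhole: a path of depth d visits d + 1 distinct vertices. This shows that the fuel
  -- suffices.
  depth-< : ∀ {v} (r : Reaches p v) → depth r < N
  depth-< r = Fin.injective⇒≤ {f = path r} (path-injective r)

module _ {n} (p : Parent n) where

  isRoot⁺ : ∀ {v} → lookup p v ≡ nothing → T (isRoot p v)
  isRoot⁺ e rewrite e = tt

  isRoot⁻ : ∀ {v} → T (isRoot p v) → lookup p v ≡ nothing
  isRoot⁻ {v} t with lookup p v
  ... | nothing = refl

  reachesRoot⁺ : ∀ {v} (r : Reaches p v) {fuel} → depth r ≤ fuel → T (reachesRoot p fuel v)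
  reachesRoot⁺ (root e)   d rewrite e = tt
  reachesRoot⁺ (step e r) (s≤s d) rewrite e = reachesRoot⁺ r d

  reachesRoot⁻ : ∀ fuel {v} → T (reachesRoot p fuel v) → Reaches p v
  reachesRoot⁻ fuel {v} t with lookup p v in eq
  reachesRoot⁻ fuel       t | nothing = root eq
  reachesRoot⁻ (suc fuel) t | just u  = step eq (reachesRoot⁻ fuel t)

  inMaxDec : Fin (suc n) → Bool
  inMaxDec = inMD p (suc n)

  inMaxDec-root : ∀ {v} → lookup p v ≡ nothing → inMaxDec v ≡ true
  inMaxDec-root e rewrite e = refl

  private
    inMD-step : ∀ {v u} fuel → lookup p v ≡ just u → inMD p (suc fuel) v ≡ (toℕ v ℕ.<ᵇ toℕ u) ∧ inMD p fuel u
    inMD-step fuel e rewrite e = refl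

    inMD-fuel : ∀ {v} (r : Reaches p v) {fuel} → depth r ≤ fuel → inMD p fuel v ≡ inMD p (suc fuel) v
    inMD-fuel (root e)               d rewrite e = refl
    inMD-fuel {v} (step {u} e r) {suc fuel} (s≤s d) = trans (inMD-step fuel e)
      (trans (cong ((toℕ v ℕ.<ᵇ toℕ u) ∧_) (inMD-fuel r d)) (sym (inMD-step (suc fuel) e)))

  -- Unfolding costs one unit of fuel; the remaining `n` units cover every depth, so `inMD-fuel`
  -- restores the missing one.
  inMaxDec-step : Rooted p → ∀ {v u} → lookup p v ≡ just u → inMaxDec v ≡ (toℕ v ℕ.<ᵇ toℕ u) ∧ inMaxDec u
  inMaxDec-step reach {v} {u} e = trans (inMD-step n e)
    (cong ((toℕ v ℕ.<ᵇ toℕ u) ∧_) (inMD-fuel (reach u) (ℕ.s≤s⁻¹ (depth-< (reach u)))))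

  root-of : ∀ {v} → Reaches p v → ∃ λ r → lookup p r ≡ nothing
  root-of {v} (root e)   = v , e
  root-of     (step _ r) = root-of r

  maxDec-≤-root : ∀ {v} → Rooted p → Reaches p v → T (inMaxDec v) → ∃ λ r → lookup p r ≡ nothing × toℕ v ≤ toℕ r
  maxDec-≤-root {v} reach (root e)       t = v , e , ℕ.≤-refl
  maxDec-≤-root {v} reach (step {u} e s) t
    with v<u , t′ ← to (T-∧ {toℕ v ℕ.<ᵇ toℕ u}) (subst T (inMaxDec-step reach e) t)
    with r , e′ , u≤r ← maxDec-≤-root reach s t′ = r , e′ , ℕ.≤-trans (ℕ.<⇒≤ (ℕ.<ᵇ⇒< _ _ v<u)) u≤r

  UniqueRoot : Set
  UniqueRoot = ∀ {v u} → lookup p v ≡ nothing → lookup p u ≡ nothing → v ≡ u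

  isTree⁻ : T (isTree p) → Rooted p × UniqueRoot
  isTree⁻ t with one-root , reaching ← to (T-∧ {count (isRoot p) (allFin (suc n)) ℕ.≡ᵇ 1}) t = reach , unique
    where
    reach : Rooted p
    reach v = reachesRoot⁻ (suc n) (all-allFin⁻ (reachesRoot p (suc n)) reaching v)
    ⟦T⟧ : ∀ {b} → T b → ⟦ b ⟧ ≡ 1ℤ
    ⟦T⟧ {true} _ = refl
    unique : UniqueRoot
    unique {v} {u} ev eu with v Fin.≟ u in v≟u
    ... | yes v≡u = v≡u
    -- Taking two distinct roots out of the count one after the other shows that it is at least 2.
    ... | no  v≢u = ⊥-elim (two-roots (begin
        + 1
          ≡⟨ cong +_ (sym (ℕ.≡ᵇ⇒≡ _ 1 one-root)) ⟩
        + size (isRoot p)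
          ≡⟨ size-remove (isRoot p) v ⟩
        + size (remove v (isRoot p)) + ⟦ isRoot p v ⟧
          ≡⟨ cong₂ _+_ (size-remove (remove v (isRoot p)) u) (⟦T⟧ (isRoot⁺ ev)) ⟩
        + size (remove u (remove v (isRoot p))) + ⟦ remove v (isRoot p) u ⟧ + 1ℤ
          ≡⟨ cong (λ z → + size (remove u (remove v (isRoot p))) + z + 1ℤ)
               (⟦T⟧ (from (T-∧ {isRoot p u}) (isRoot⁺ eu , subst (λ d → T (not (does d))) (sym v≟u) tt))) ⟩
        + (size (remove u (remove v (isRoot p))) ℕ.+ 1 ℕ.+ 1) ∎))
      where
      two-roots : ∀ {s} → + 1 ≡ + (s ℕ.+ 1 ℕ.+ 1) → ⊥
      two-roots {s} e with () ← trans (ℤ.+-injective e) (trans (ℕ.+-assoc s 1 1) (ℕ.+-comm s 2))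

  isTree⁺ : Rooted p → UniqueRoot → T (isTree p)
  isTree⁺ reach unique = from (T-∧ {count (isRoot p) (allFin (suc n)) ℕ.≡ᵇ 1})
    ( ℕ.≡⇒≡ᵇ (size (isRoot p)) 1 (ℤ.+-injective one-root)
    , all-allFin⁺ (reachesRoot p (suc n)) (λ v → reachesRoot⁺ (reach v) (ℕ.<⇒≤ (depth-< (reach v)))))
    where
    r : Fin (suc n)
    r = proj₁ (root-of (reach zero))
    r-root : lookup p r ≡ nothing
    r-root = proj₂ (root-of (reach zero))
    no-other : ∀ v → ⟦ remove r (isRoot p) v ⟧ ≡ 0ℤ
    no-other v with r Fin.≟ v
    ... | yes _   = cong ⟦_⟧ (Bool.∧-zeroʳ (isRoot p v))
    ... | no  r≢v = cong ⟦_⟧ (T-ext {isRoot p v ∧ true} {false}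
      (λ t → r≢v (unique r-root (isRoot⁻ (proj₁ (to (T-∧ {isRoot p v}) t))))) λ ())
    one-root : + size (isRoot p) ≡ + 1
    one-root = trans (size-remove (isRoot p) r) (cong₂ _+_
      (trans (∑-count (remove r (isRoot p)) (allFin (suc n))) (∑-zero-cong (allFin (suc n)) no-other))
      (cong ⟦_⟧ (to T-≡ (isRoot⁺ r-root))))

-- Trees with prescribed maximal decreasing subtree

⟦∧⟧ : ∀ a b → ⟦ a ∧ b ⟧ ≡ ⟦ a ⟧ * ⟦ b ⟧
⟦∧⟧ true  b = sym (ℤ.*-identityˡ ⟦ b ⟧)
⟦∧⟧ false b = sym (ℤ.*-zeroˡ ⟦ b ⟧)

every : ∀ {m} → (Fin m → A → Bool) → Vec A m → Bool
every P []      = true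
every P (x ∷ p) = P zero x ∧ every (P ∘ suc) p

weight-every : ∀ {m} (P : Fin m → A → Bool) p → weight (λ v x → ⟦ P v x ⟧) p ≡ ⟦ every P p ⟧
weight-every P []      = refl
weight-every P (x ∷ p) = trans (cong (⟦ P zero x ⟧ *_) (weight-every (P ∘ suc) p))
  (sym (⟦∧⟧ (P zero x) (every (P ∘ suc) p)))

every⁺ : ∀ {m} (P : Fin m → A → Bool) p → (∀ v → T (P v (lookup p v))) → T (every P p)
every⁺ P []      h = tt
every⁺ P (x ∷ p) h = from (T-∧ {P zero x}) (h zero , every⁺ (P ∘ suc) p (h ∘ suc))

every⁻ : ∀ {m} (P : Fin m → A → Bool) p → T (every P p) → ∀ v → T (P v (lookup p v))
every⁻ P (x ∷ p) t zero    = proj₁ (to (T-∧ {P zero x}) t)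
every⁻ P (x ∷ p) t (suc v) = every⁻ (P ∘ suc) p (proj₂ (to (T-∧ {P zero x}) t)) v

ones-zero⁺ : ∀ {N} (M : Vec Bool N) → (∀ u → ¬ T (lookup M u)) → ones M ≡ 0
ones-zero⁺ []          h = refl
ones-zero⁺ (true  ∷ M) h = ⊥-elim (h zero tt)
ones-zero⁺ (false ∷ M) h = ones-zero⁺ M (h ∘ suc)

ones-zero⁻ : ∀ {N} (M : Vec Bool N) → ones M ≡ 0 → ∀ u → ¬ T (lookup M u)
ones-zero⁻ (false ∷ M) e (suc u) = ones-zero⁻ M e u

isTop⁺ : ∀ {N} (M : Vec Bool N) v → T (lookup M v) → (∀ u → T (lookup M u) → toℕ u ≤ toℕ v) → T (isTop M v)
isTop⁺ (true ∷ M) zero    Mv h = ℕ.≡⇒≡ᵇ _ 0 (ones-zero⁺ M (λ u Mu → contradiction (h (suc u) Mu) λ ()))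
isTop⁺ (m ∷ M)    (suc v) Mv h = isTop⁺ M v Mv (λ u Mu → ℕ.s≤s⁻¹ (h (suc u) Mu))

isTop-marked : ∀ {N} (M : Vec Bool N) v → T (isTop M v) → T (lookup M v)
isTop-marked (true ∷ M) zero    t = tt
isTop-marked (m ∷ M)    (suc v) t = isTop-marked M v t

isTop-greatest : ∀ {N} (M : Vec Bool N) v u → T (isTop M v) → T (lookup M u) → toℕ u ≤ toℕ v
isTop-greatest M          v       zero    t Mu = z≤n
isTop-greatest (true ∷ M) zero    (suc u) t Mu = ⊥-elim (ones-zero⁻ M (ℕ.≡ᵇ⇒≡ _ 0 t) u Mu)
isTop-greatest (m ∷ M)    (suc v) (suc u) t Mu = s≤s (isTop-greatest M v u t Mu)

sameVec : ∀ {N} → Vec Bool N → Vec Bool N → Bool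
sameVec M M′ = does (Vec.≡-dec Bool._≟_ M M′)

∑-bools-sift : ∀ {N} (M : Vec Bool N) (f : Vec Bool N → ℤ) →
               ∑ (allVecs bools N) (λ M′ → ⟦ sameVec M M′ ⟧ * f M′) ≡ f M
∑-bools-sift []          f = trans (∑-[-] [] _) (ℤ.*-identityˡ (f []))
∑-bools-sift (true  ∷ M) f = trans (∑-bools-suc _ _) (trans (cong₂ _+_
  (∑-bools-sift M (f ∘ (true ∷_)))
  (∑-zero-cong _ (λ M′ → ℤ.*-zeroˡ (f (false ∷ M′))))) (ℤ.+-identityʳ _))
∑-bools-sift (false ∷ M) f = trans (∑-bools-suc _ _) (trans (cong₂ _+_
  (∑-zero-cong _ (λ M′ → ℤ.*-zeroˡ (f (true ∷ M′))))
  (∑-bools-sift M (f ∘ (false ∷_)))) (ℤ.+-identityˡ _))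

maxDec : ∀ {n} → Parent n → Vec Bool (suc n)
maxDec p = Vec.tabulate (inMaxDec p)

ones-tabulate : ∀ {N} (P : Fin N → Bool) → ones (Vec.tabulate P) ≡ size P
ones-tabulate {N} P = ℤ.+-injective (begin
  + ones (Vec.tabulate P)                                 ≡⟨ sym (∑-ones (Vec.tabulate P)) ⟩
  ∑ (allFin N) (λ u → ⟦ lookup (Vec.tabulate P) u ⟧)      ≡⟨ ∑-cong (allFin N) (λ u → cong ⟦_⟧ (Vec.lookup∘tabulate P u)) ⟩
  ∑ (allFin N) (⟦_⟧ ∘ P)                                  ≡⟨ sym (∑-count P (allFin N)) ⟩
  + size P                                                ∎)

private
  -- The local conditions of `allowed` force the recursion of `inMD`: a vertex is marked exactly
  -- when its parent is marked and greater.
  marked-step : ∀ {N} a b {v u : Fin N} →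
                T (if a then b ∧ (toℕ v ℕ.<ᵇ toℕ u) else (not b ∨ (toℕ u ℕ.<ᵇ toℕ v))) →
                (toℕ v ℕ.<ᵇ toℕ u) ∧ b ≡ a
  marked-step true true {v} {u} t = trans (Bool.∧-identityʳ _) (to T-≡ t)
  marked-step false false {v} {u} t = Bool.∧-zeroʳ _
  marked-step false true {v} {u} t = T-ext
    (λ s → ℕ.<-asym
      (ℕ.<ᵇ⇒< (toℕ v) (toℕ u) (proj₁ (to (T-∧ {toℕ v ℕ.<ᵇ toℕ u}) s)))
      (ℕ.<ᵇ⇒< (toℕ u) (toℕ v) t)) λ ()

  -- Failure of v < u gives u < v only once equality is excluded, hence `v ≢ u`.
  allowed-step : ∀ {N} a b {v u : Fin N} → (toℕ v ℕ.<ᵇ toℕ u) ∧ b ≡ a → v ≢ u →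
                 T (if a then b ∧ (toℕ v ℕ.<ᵇ toℕ u) else (not b ∨ (toℕ u ℕ.<ᵇ toℕ v)))
  allowed-step true b {v} {u} e v≢u = subst T (trans (sym e) (Bool.∧-comm (toℕ v ℕ.<ᵇ toℕ u) b)) tt
  allowed-step false false {v} {u} e v≢u = tt
  allowed-step false true {v} {u} e v≢u with ℕ.<-cmp (toℕ v) (toℕ u)
  ... | tri< v<u _ _ = ⊥-elim (subst T (trans (sym (Bool.∧-identityʳ _)) e) (ℕ.<⇒<ᵇ v<u))
  ... | tri≈ _ v≡u _ = contradiction (Fin.toℕ-injective v≡u) v≢u
  ... | tri> _ _ u<v = ℕ.<⇒<ᵇ u<v

module _ {n} (p : Parent n) (M : Vec Bool (suc n)) where

  -- Induction along the path: a root is marked because only the greatest marked vertex may lack a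
  -- parent, and away from it the marks obey the recursion of `inMD`.
  allowed⇒maxDec : Rooted p → (∀ v → T (allowed M v (lookup p v))) → ∀ {v} → Reaches p v →
                   inMaxDec p v ≡ lookup M v
  allowed⇒maxDec reach ok {v} (root e) = trans (inMaxDec-root p e)
    (sym (to T-≡ (isTop-marked M v (subst (T ∘ allowed M v) e (ok v)))))
  allowed⇒maxDec reach ok {v} (step {u} e r) = begin
    inMaxDec p v                                ≡⟨ inMaxDec-step p reach e ⟩
    (toℕ v ℕ.<ᵇ toℕ u) ∧ inMaxDec p u           ≡⟨ cong ((toℕ v ℕ.<ᵇ toℕ u) ∧_) (allowed⇒maxDec reach ok r) ⟩
    (toℕ v ℕ.<ᵇ toℕ u) ∧ lookup M u
      ≡⟨ marked-step (lookup M v) (lookup M u) {v} {u} (subst (T ∘ allowed M v) e (ok v)) ⟩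
    lookup M v                                  ∎

  allowed⇒uniqueRoot : (∀ v → T (allowed M v (lookup p v))) → UniqueRoot p
  allowed⇒uniqueRoot ok {v} {u} ev eu = Fin.toℕ-injective (ℕ.≤-antisym
    (isTop-greatest M u v (top u eu) (isTop-marked M v (top v ev)))
    (isTop-greatest M v u (top v ev) (isTop-marked M u (top u eu))))
    where
    top : ∀ v → lookup p v ≡ nothing → T (isTop M v)
    top v e = subst (T ∘ allowed M v) e (ok v)

  -- Labels increase from any marked vertex up to the root, so the root is the greatest marked
  -- vertex. Other vertices satisfy the local conditions by `allowed-step`, as a rooted map has no
  -- loops.
  maxDec⇒allowed : Rooted p → UniqueRoot p → (∀ v → inMaxDec p v ≡ lookup M v) →
                   ∀ v → T (allowed M v (lookup p v))
  maxDec⇒allowed reach unique same v with lookup p v in eq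
  ... | nothing = isTop⁺ M v (subst T (trans (sym (inMaxDec-root p eq)) (same v)) tt) greatest
    where
    greatest : ∀ u → T (lookup M u) → toℕ u ≤ toℕ v
    greatest u Mu with r , er , u≤r ← maxDec-≤-root p reach (reach u) (subst T (sym (same u)) Mu)
      = subst (λ r → toℕ u ≤ toℕ r) (unique er eq) u≤r
  ... | just u  = allowed-step (lookup M v) (lookup M u) {v} {u}
    (trans (cong ((toℕ v ℕ.<ᵇ toℕ u) ∧_) (sym (same u))) (trans (sym (inMaxDec-step p reach eq)) (same v)))
    λ { refl → no-loop eq (reach v) }

  -- Acyclicity alone permits several roots; `allowed` reduces them to one, since every root must be
  -- the greatest marked vertex.
  allowed∧acyclic : every (allowed M) p ∧ acyclic p ≡ sameVec (maxDec p) M ∧ isTree p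
  allowed∧acyclic = T-ext forth back
    where
    forth : T (every (allowed M) p ∧ acyclic p) → T (sameVec (maxDec p) M ∧ isTree p)
    forth t with ok , acyc ← to (T-∧ {every (allowed M) p}) t = from (T-∧ {sameVec (maxDec p) M})
      (same , isTree⁺ p reach (allowed⇒uniqueRoot (every⁻ (allowed M) p ok)))
      where
      reach : Rooted p
      reach = acyclic⁻ p acyc
      same : T (sameVec (maxDec p) M)
      same with Vec.≡-dec Bool._≟_ (maxDec p) M
      ... | yes _ = tt
      ... | no  ≢M = ≢M (trans (Vec.tabulate-cong (λ v → allowed⇒maxDec reach (every⁻ (allowed M) p ok) (reach v)))
                          (Vec.tabulate∘lookup M))
    back : T (sameVec (maxDec p) M ∧ isTree p) → T (every (allowed M) p ∧ acyclic p)
    back t with Vec.≡-dec Bool._≟_ (maxDec p) M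
    ... | yes ≡M with reach , unique ← isTree⁻ p t = from (T-∧ {every (allowed M) p})
      ( every⁺ (allowed M) p (maxDec⇒allowed reach unique
          (λ v → trans (sym (Vec.lookup∘tabulate (inMaxDec p) v)) (cong (λ M → lookup M v) ≡M)))
      , acyclic⁺ p reach)

-- A tree has exactly one maximal decreasing subtree, so only `M = maxDec p` survives, and the
-- indicator tests its size.
tree-decomposition : ∀ {n} k (p : Parent n) → ⟦ isTree p ∧ (mdSize p ℕ.≡ᵇ k) ⟧ ≡
  ∑ (allVecs bools (suc n)) (λ M → ⟦ ones M ℕ.≡ᵇ k ⟧ * (weight (λ v t → ⟦ allowed M v t ⟧) p * ⟦ acyclic p ⟧))
tree-decomposition {n} k p = sym (begin
  ∑ (allVecs bools (suc n)) (λ M → ⟦ ones M ℕ.≡ᵇ k ⟧ * (weight (λ v t → ⟦ allowed M v t ⟧) p * ⟦ acyclic p ⟧))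
    ≡⟨ ∑-cong _ term ⟩
  ∑ (allVecs bools (suc n)) (λ M → ⟦ sameVec (maxDec p) M ⟧ * (⟦ isTree p ⟧ * ⟦ ones M ℕ.≡ᵇ k ⟧))
    ≡⟨ ∑-bools-sift (maxDec p) _ ⟩
  ⟦ isTree p ⟧ * ⟦ ones (maxDec p) ℕ.≡ᵇ k ⟧
    ≡⟨ cong (λ s → ⟦ isTree p ⟧ * ⟦ s ℕ.≡ᵇ k ⟧) (ones-tabulate (inMaxDec p)) ⟩
  ⟦ isTree p ⟧ * ⟦ mdSize p ℕ.≡ᵇ k ⟧
    ≡⟨ sym (⟦∧⟧ (isTree p) (mdSize p ℕ.≡ᵇ k)) ⟩
  ⟦ isTree p ∧ (mdSize p ℕ.≡ᵇ k) ⟧ ∎)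
  where
  rotate : ∀ a b c → a * (b * c) ≡ b * (c * a)
  rotate = solve-∀
  term : ∀ M → ⟦ ones M ℕ.≡ᵇ k ⟧ * (weight (λ v t → ⟦ allowed M v t ⟧) p * ⟦ acyclic p ⟧) ≡
               ⟦ sameVec (maxDec p) M ⟧ * (⟦ isTree p ⟧ * ⟦ ones M ℕ.≡ᵇ k ⟧)
  term M = begin
    ⟦ ones M ℕ.≡ᵇ k ⟧ * (weight (λ v t → ⟦ allowed M v t ⟧) p * ⟦ acyclic p ⟧)
      ≡⟨ cong (λ z → ⟦ ones M ℕ.≡ᵇ k ⟧ * (z * ⟦ acyclic p ⟧)) (weight-every (allowed M) p) ⟩
    ⟦ ones M ℕ.≡ᵇ k ⟧ * (⟦ every (allowed M) p ⟧ * ⟦ acyclic p ⟧)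
      ≡⟨ cong (⟦ ones M ℕ.≡ᵇ k ⟧ *_) (trans (sym (⟦∧⟧ (every (allowed M) p) (acyclic p)))
           (trans (cong ⟦_⟧ (allowed∧acyclic p M)) (⟦∧⟧ (sameVec (maxDec p) M) (isTree p)))) ⟩
    ⟦ ones M ℕ.≡ᵇ k ⟧ * (⟦ sameVec (maxDec p) M ⟧ * ⟦ isTree p ⟧)
      ≡⟨ rotate ⟦ ones M ℕ.≡ᵇ k ⟧ ⟦ sameVec (maxDec p) M ⟧ ⟦ isTree p ⟧ ⟩
    ⟦ sameVec (maxDec p) M ⟧ * (⟦ isTree p ⟧ * ⟦ ones M ℕ.≡ᵇ k ⟧) ∎

cardT-Δ : ∀ n k → + cardT n k ≡ Δ k n (+ n - + k)
cardT-Δ n k = begin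
  + cardT n k
    ≡⟨ ∑-count _ parents ⟩
  ∑ parents (λ p → ⟦ isTree p ∧ (mdSize p ℕ.≡ᵇ suc k) ⟧)
    ≡⟨ ∑-cong parents (tree-decomposition (suc k)) ⟩
  ∑ parents (λ p → ∑ marks (λ M → ⟦ ones M ℕ.≡ᵇ suc k ⟧ * (weight (λ v t → ⟦ allowed M v t ⟧) p * ⟦ acyclic p ⟧)))
    ≡⟨ ∑-swap parents marks _ ⟩
  ∑ marks (λ M → ∑ parents (λ p → ⟦ ones M ℕ.≡ᵇ suc k ⟧ * (weight (λ v t → ⟦ allowed M v t ⟧) p * ⟦ acyclic p ⟧)))
    ≡⟨ ∑-cong marks (λ M → ∑-*ˡ parents ⟦ ones M ℕ.≡ᵇ suc k ⟧ _) ⟩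
  ∑ marks (λ M → ⟦ ones M ℕ.≡ᵇ suc k ⟧ * forestSum (λ v t → ⟦ allowed M v t ⟧))
    ≡⟨ ∑-forests n k ⟩
  Δ k n (+ n - + k) ∎
  where
  parents : List (Parent n)
  parents = allVecs (targets (suc n)) (suc n)
  marks : List (Vec Bool (suc n))
  marks = allVecs bools (suc n)

theorem2p3 : (n k : ℕ) → (cardT n k ≡ cardF n k) × (+ lhs n k ≡ rhs n k)
theorem2p3 n k = ℤ.+-injective (trans (cardT-Δ n k) (sym (cardF-Δ n k))) , trans (lhs-Δ n k) (sym (rhs-Δ n k))
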